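{- Every dual LNL model is a dual linear category. That is, if $\mathcal{L} : \mathsf{H} \dashv \mathsf{J} : \mathcal{C}$ is a dual LNL model with unit $\eta$ and counit $\varepsilon$, then the symmetric monoidal coclosed category $\mathcal{L}$, together with the symmetric comonoidal monad $(?, \eta, \mu)$ given by $?A = \mathsf{J}\mathsf{H}A$ and $\mu_A = \mathsf{J}\varepsilon_{\mathsf{H}A}$, is a dual linear category.
   Context: Composition is written in diagrammatic order, $f;g$. A symmetric monoidal category is written $(\mathcal{M},\perp,\oplus)$ with structural isomorphisms $\lambda_A : \perp\oplus A\to A$, $\rho_A : A\oplus\perp\to A$, $\alpha_{A,B,C} : (A\oplus B)\oplus C\to A\oplus(B\oplus C)$ and symmetry $\beta_{A,B} : A\oplus B\to B\oplus A$. It is coclosed if for every object $B$ the functor $-\oplus B$ has a specified left adjoint $(-)\mathbin{\bullet\!- }B$, i.e. $\mathrm{Hom}(C, A\oplus B)\cong \mathrm{Hom}(C\mathbin{\bullet\!- }B, A)$ naturally. A cocartesian category $(\mathcal{C},0,+)$ is a category with an initial object $0$ and binary coproducts $+$, regarded as a symmetric monoidal category; it is coclosed if it is coclosed as such (the left adjoint is written $S-T$). A symmetric comonoidal functor $(F,m)$ from $\mathcal{M}_1$ to $\mathcal{M}_2$ is a functor $F$ with a map $m_\perp : F\perp_1\to\perp_2$ and a natural transformation $m_{A,B} : F(A\oplus_1 B)\to FA\oplus_2 FB$ such that $m_{A\oplus B,C};(m_{A,B}\oplus \mathrm{id});\alpha = F\alpha; m_{A,B\oplus C};(\mathrm{id}\oplus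 m_{B,C})$, $m_{\perp,A};(m_\perp\oplus\mathrm{id}) = F\lambda_A;\lambda^{ -1}_{FA}$, $m_{A,\perp};(\mathrm{id}\oplus m_\perp) = F\rho_A;\rho^{ -1}_{FA}$, and $m_{A,B};\beta = F\beta; m_{B,A}$. A symmetric comonoidal natural transformation $f:(F,m)\to(G,n)$ is a natural transformation with $m_{A,B};(f_A\oplus f_B) = f_{A\oplus B};n_{A,B}$ and $f_\perp;n_\perp = m_\perp$. Composites of symmetric comonoidal functors are symmetric comonoidal in the evident way, and the identity functor is symmetric comonoidal. A symmetric comonoidal adjunction is an adjunction between symmetric comonoidal functors whose unit and counit are symmetric comonoidal natural transformations. A symmetric comonoidal monad is a monad $(T,\eta,\mu)$ with $T$ a symmetric comonoidal endofunctor and $\eta,\mu$ symmetric comonoidal natural transformations. A dual LNL model $\mathcal{L} : \mathsf{H} \dashv \mathsf{J} : \mathcal{C}$ consists of a symmetric monoidal coclosed category $(\mathcal{L},\perp,\oplus,\bullet\!-)$, a cocartesian coclosed category $(\mathcal{C},0,+,-)$, and a symmetric comonoidal adjunction with left adjoint $\mathsf{H}:\mathcal{L}\to\mathcal{C}$ and right adjoint $\mathsf{J}:\mathcal{C}\to\mathcal{L}$, with unit $\eta_A:A\to\mathsf{J}\mathsf{H}A$ and counit $\varepsilon_R:\mathsf{H}\mathsf{J}R\to R$. A dual linear category is a symmetric monoidal coclosed category $(\mathcal{L},\perp,\oplus,\bullet\!-)$ with a symmetric comonoidal monad $(?,\eta,\mu)$ (comonoidal structure maps $r_\perp:?\perp\to\perp$,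 $r_{A,B}:?(A\oplus B)\to ?A\oplus ?B$) such that: (a) each free $?$-algebra $(?A,\mu_A)$ carries naturally the structure of a commutative $\oplus$-monoid: there are distinguished symmetric comonoidal natural transformations $w_A:\perp\to ?A$ and $c_A:?A\oplus ?A\to ?A$ such that $(?A,w_A,c_A)$ is a commutative monoid in $(\mathcal{L},\perp,\oplus)$ and $w_A,c_A$ are $?$-algebra morphisms, where $\perp$ carries the algebra structure $r_\perp$, $?A$ carries $\mu_A$, and $?A\oplus ?A$ carries $r_{?A,?A};(\mu_A\oplus\mu_A)$. Here the source of $w$ is the constant functor $W(A)=\perp$ with comonoidal structure $\mathrm{id}_\perp$ and $\rho_\perp^{ -1}:\perp\to\perp\oplus\perp$, and the source of $c$ is the functor $A\mapsto ?A\oplus ?A$ with comonoidal structure $(r_\perp\oplus r_\perp);\lambda_\perp$ and $(r_{A,B}\oplus r_{A,B})$ followed by the canonical isomorphism $(?A\oplus ?B)\oplus(?A\oplus ?B)\cong(?A\oplus ?A)\oplus(?B\oplus ?B)$; (b) whenever $f:(?A,\mu_A)\to(?B,\mu_B)$ is a morphism of free $?$-algebras, it is also a monoid morphism, i.e. $w_A;f=w_B$ and $c_A;f=(f\oplus f);c_B$. -}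

module Defs where

open import Level using (Level; _⊔_; suc)
open import Data.Product.Base using (_,_; _×_)
open import Function.Bundles using (Inverse)
open import Relation.Binary using (Rel; IsEquivalence; Setoid)
import Relation.Binary.Reasoning.Setoid as SetoidReasoning

------------------------------------------------------------------------
-- Categories, functors, natural transformations, adjunctions

-- Homs are setoids, and composition is in diagrammatic order.
record Category (o ℓ e : Level) : Set (suc (o ⊔ ℓ ⊔ e)) where
  infix  4 _⇒_ _≈_
  infixl 7 _⨾_
  field
    Obj      : Set o
    _⇒_      : Rel Obj ℓ
    _≈_      : ∀ {A B} → Rel (A ⇒ B) e
    id       : ∀ {A} → A ⇒ A
    _⨾_      : ∀ {A B C} → A ⇒ B → B ⇒ C → A ⇒ C
    equiv    : ∀ {A B} → IsEquivalence (_≈_ {A} {B})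
    ⨾-resp-≈ : ∀ {A B C} {f f′ : A ⇒ B} {g g′ : B ⇒ C} →
               f ≈ f′ → g ≈ g′ → f ⨾ g ≈ f′ ⨾ g′
    idˡ      : ∀ {A B} {f : A ⇒ B} → id ⨾ f ≈ f
    idʳ      : ∀ {A B} {f : A ⇒ B} → f ⨾ id ≈ f
    assoc    : ∀ {A B C D} {f : A ⇒ B} {g : B ⇒ C} {h : C ⇒ D} →
               (f ⨾ g) ⨾ h ≈ f ⨾ (g ⨾ h)

  module Equiv {A B : Obj} = IsEquivalence (equiv {A} {B})

  homSetoid : (A B : Obj) → Setoid ℓ e
  homSetoid A B = record { Carrier = A ⇒ B ; _≈_ = _≈_ ; isEquivalence = equiv }

  module HomReasoning {A B : Obj} = SetoidReasoning (homSetoid A B)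

  infixr 6 _⟨⨾⟩_
  _⟨⨾⟩_ : ∀ {A B C} {f f′ : A ⇒ B} {g g′ : B ⇒ C} →
          f ≈ f′ → g ≈ g′ → f ⨾ g ≈ f′ ⨾ g′
  _⟨⨾⟩_ = ⨾-resp-≈

  pullˡ : ∀ {A B C D} {f : A ⇒ B} {g : B ⇒ C} {k : A ⇒ C} {h : C ⇒ D} →
          f ⨾ g ≈ k → f ⨾ (g ⨾ h) ≈ k ⨾ h
  pullˡ p = Equiv.trans (Equiv.sym assoc) (p ⟨⨾⟩ Equiv.refl)

record Functor {o ℓ e o′ ℓ′ e′} (𝓒 : Category o ℓ e) (𝓓 : Category o′ ℓ′ e′)
       : Set (o ⊔ ℓ ⊔ e ⊔ o′ ⊔ ℓ′ ⊔ e′) where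
  private
    module C = Category 𝓒
    module D = Category 𝓓
  field
    F₀       : C.Obj → D.Obj
    F₁       : ∀ {A B} → A C.⇒ B → F₀ A D.⇒ F₀ B
    F-resp-≈ : ∀ {A B} {f g : A C.⇒ B} → f C.≈ g → F₁ f D.≈ F₁ g
    F-id     : ∀ {A} → F₁ (C.id {A}) D.≈ D.id
    F-⨾      : ∀ {A B C} {f : A C.⇒ B} {g : B C.⇒ C} →
               F₁ (f C.⨾ g) D.≈ F₁ f D.⨾ F₁ g

idF : ∀ {o ℓ e} {𝓒 : Category o ℓ e} → Functor 𝓒 𝓒
idF {𝓒 = 𝓒} = record
  { F₀ = λ A → A ; F₁ = λ f → f ; F-resp-≈ = λ p → p
  ; F-id = Equiv.refl ; F-⨾ = Equiv.refl }
  where open Category 𝓒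

constF : ∀ {o ℓ e o′ ℓ′ e′} {𝓒 : Category o ℓ e} {𝓓 : Category o′ ℓ′ e′} →
         Category.Obj 𝓓 → Functor 𝓒 𝓓
constF {𝓓 = 𝓓} X = record
  { F₀ = λ _ → X ; F₁ = λ _ → id ; F-resp-≈ = λ _ → Equiv.refl
  ; F-id = Equiv.refl ; F-⨾ = Equiv.sym idˡ }
  where open Category 𝓓

-- "first F, then G"
infixl 9 _⨾F_
_⨾F_ : ∀ {o ℓ e o′ ℓ′ e′ o″ ℓ″ e″} {𝓐 : Category o ℓ e} {𝓑 : Category o′ ℓ′ e′}
         {𝓒 : Category o″ ℓ″ e″} → Functor 𝓐 𝓑 → Functor 𝓑 𝓒 → Functor 𝓐 𝓒
_⨾F_ {𝓒 = 𝓒} F G = record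
  { F₀       = λ A → G.F₀ (F.F₀ A)
  ; F₁       = λ f → G.F₁ (F.F₁ f)
  ; F-resp-≈ = λ p → G.F-resp-≈ (F.F-resp-≈ p)
  ; F-id     = Equiv.trans (G.F-resp-≈ F.F-id) G.F-id
  ; F-⨾      = Equiv.trans (G.F-resp-≈ F.F-⨾) G.F-⨾ }
  where
    open Category 𝓒
    module F = Functor F
    module G = Functor G

record NaturalTransformation {o ℓ e o′ ℓ′ e′}
       {𝓒 : Category o ℓ e} {𝓓 : Category o′ ℓ′ e′} (F G : Functor 𝓒 𝓓)
       : Set (o ⊔ ℓ ⊔ e ⊔ o′ ⊔ ℓ′ ⊔ e′) where
  private
    module C = Category 𝓒
    module F = Functor F
    module G = Functor G
  open Category 𝓓
  field
    η       : ∀ A → F.F₀ A ⇒ G.F₀ A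
    natural : ∀ {A B} (f : A C.⇒ B) → F.F₁ f ⨾ η B ≈ η A ⨾ G.F₁ f

record Adjunction {o ℓ e o′ ℓ′ e′} {𝓒 : Category o ℓ e} {𝓓 : Category o′ ℓ′ e′}
       (L : Functor 𝓒 𝓓) (R : Functor 𝓓 𝓒)
       : Set (o ⊔ ℓ ⊔ e ⊔ o′ ⊔ ℓ′ ⊔ e′) where
  private
    module C = Category 𝓒
    module D = Category 𝓓
    module L = Functor L
    module R = Functor R
  field
    unit   : NaturalTransformation idF (L ⨾F R)
    counit : NaturalTransformation (R ⨾F L) idF
  module unit   = NaturalTransformation unit
  module counit = NaturalTransformation counit
  field
    zig : ∀ {A} → L.F₁ (unit.η A) D.⨾ counit.η (L.F₀ A) D.≈ D.id
    zag : ∀ {B} → unit.η (R.F₀ B) C.⨾ R.F₁ (counit.η B) C.≈ C.id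

  -- The natural bijection Hom(A , R B) ≅ Hom(L A , B).

  homIso : ∀ A B → Inverse (C.homSetoid A (R.F₀ B)) (D.homSetoid (L.F₀ A) B)
  homIso A B = record
    { to        = to
    ; from      = from
    ; to-cong   = to-cong
    ; from-cong = from-cong
    ; inverse   = (λ p → D.Equiv.trans (to-cong p) to∘from)
                , (λ p → C.Equiv.trans (from-cong p) from∘to) }
    where
      to : A C.⇒ R.F₀ B → L.F₀ A D.⇒ B
      to f = L.F₁ f D.⨾ counit.η B
      from : L.F₀ A D.⇒ B → A C.⇒ R.F₀ B
      from g = unit.η A C.⨾ R.F₁ g
      to-cong : ∀ {f f′} → f C.≈ f′ → to f D.≈ to f′
      to-cong p = L.F-resp-≈ p D.⟨⨾⟩ D.Equiv.refl
      from-cong : ∀ {g g′} → g D.≈ g′ → from g C.≈ from g′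
      from-cong p = C.Equiv.refl C.⟨⨾⟩ R.F-resp-≈ p
      to∘from : ∀ {g} → to (from g) D.≈ g
      to∘from {g} = begin
        L.F₁ (unit.η A C.⨾ R.F₁ g) D.⨾ counit.η B              ≈⟨ L.F-⨾ D.⟨⨾⟩ D.Equiv.refl ⟩
        (L.F₁ (unit.η A) D.⨾ L.F₁ (R.F₁ g)) D.⨾ counit.η B     ≈⟨ D.assoc ⟩
        L.F₁ (unit.η A) D.⨾ (L.F₁ (R.F₁ g) D.⨾ counit.η B)     ≈⟨ D.Equiv.refl D.⟨⨾⟩ counit.natural g ⟩
        L.F₁ (unit.η A) D.⨾ (counit.η (L.F₀ A) D.⨾ g)          ≈⟨ D.pullˡ zig ⟩
        D.id D.⨾ g                                             ≈⟨ D.idˡ ⟩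
        g                                                      ∎
        where open D.HomReasoning
      from∘to : ∀ {f} → from (to f) C.≈ f
      from∘to {f} = begin
        unit.η A C.⨾ R.F₁ (L.F₁ f D.⨾ counit.η B)              ≈⟨ C.Equiv.refl C.⟨⨾⟩ R.F-⨾ ⟩
        unit.η A C.⨾ (R.F₁ (L.F₁ f) C.⨾ R.F₁ (counit.η B))     ≈⟨ C.pullˡ (C.Equiv.sym (unit.natural f)) ⟩
        (f C.⨾ unit.η (R.F₀ B)) C.⨾ R.F₁ (counit.η B)          ≈⟨ C.assoc ⟩
        f C.⨾ (unit.η (R.F₀ B) C.⨾ R.F₁ (counit.η B))          ≈⟨ C.Equiv.refl C.⟨⨾⟩ zag ⟩
        f C.⨾ C.id                                             ≈⟨ C.idʳ ⟩
        f                                                      ∎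
        where open C.HomReasoning

  homIso-natural : ∀ {A A′ B B′} (a : A′ C.⇒ A) (f : A C.⇒ R.F₀ B) (b : B D.⇒ B′) →
    Inverse.to (homIso A′ B′) ((a C.⨾ f) C.⨾ R.F₁ b)
      D.≈ (L.F₁ a D.⨾ Inverse.to (homIso A B) f) D.⨾ b
  homIso-natural {B = B} {B′} a f b = begin
    L.F₁ ((a C.⨾ f) C.⨾ R.F₁ b) D.⨾ counit.η B′
      ≈⟨ D.Equiv.trans L.F-⨾ (L.F-⨾ D.⟨⨾⟩ D.Equiv.refl) D.⟨⨾⟩ D.Equiv.refl ⟩
    ((L.F₁ a D.⨾ L.F₁ f) D.⨾ L.F₁ (R.F₁ b)) D.⨾ counit.η B′
      ≈⟨ D.assoc ⟩
    (L.F₁ a D.⨾ L.F₁ f) D.⨾ (L.F₁ (R.F₁ b) D.⨾ counit.η B′)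
      ≈⟨ D.Equiv.refl D.⟨⨾⟩ counit.natural b ⟩
    (L.F₁ a D.⨾ L.F₁ f) D.⨾ (counit.η B D.⨾ b)
      ≈⟨ D.assoc ⟨
    ((L.F₁ a D.⨾ L.F₁ f) D.⨾ counit.η B) D.⨾ b
      ≈⟨ D.assoc D.⟨⨾⟩ D.Equiv.refl ⟩
    (L.F₁ a D.⨾ (L.F₁ f D.⨾ counit.η B)) D.⨾ b ∎
    where open D.HomReasoning

------------------------------------------------------------------------
-- Symmetric monoidal categories

record SymmetricMonoidalCategory (o ℓ e : Level) : Set (suc (o ⊔ ℓ ⊔ e)) where
  infixr 10 _⊕₀_ _⊕₁_
  field
    U : Category o ℓ e
  open Category U public
  field
    ⊥        : Obj
    _⊕₀_     : Obj → Obj → Obj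
    _⊕₁_     : ∀ {A B C D} → A ⇒ B → C ⇒ D → A ⊕₀ C ⇒ B ⊕₀ D
    ⊕-resp-≈ : ∀ {A B C D} {f f′ : A ⇒ B} {g g′ : C ⇒ D} →
               f ≈ f′ → g ≈ g′ → f ⊕₁ g ≈ f′ ⊕₁ g′
    ⊕-id     : ∀ {A B} → id {A} ⊕₁ id {B} ≈ id
    ⊕-⨾      : ∀ {A B C A′ B′ C′} {f : A ⇒ B} {g : B ⇒ C} {f′ : A′ ⇒ B′} {g′ : B′ ⇒ C′} →
               (f ⨾ g) ⊕₁ (f′ ⨾ g′) ≈ (f ⊕₁ f′) ⨾ (g ⊕₁ g′)

    λ⇒ : ∀ A → ⊥ ⊕₀ A ⇒ A
    λ⇐ : ∀ A → A ⇒ ⊥ ⊕₀ A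
    ρ⇒ : ∀ A → A ⊕₀ ⊥ ⇒ A
    ρ⇐ : ∀ A → A ⇒ A ⊕₀ ⊥
    α⇒ : ∀ A B C → (A ⊕₀ B) ⊕₀ C ⇒ A ⊕₀ (B ⊕₀ C)
    α⇐ : ∀ A B C → A ⊕₀ (B ⊕₀ C) ⇒ (A ⊕₀ B) ⊕₀ C
    β  : ∀ A B → A ⊕₀ B ⇒ B ⊕₀ A

    λ-isoˡ : ∀ {A} → λ⇒ A ⨾ λ⇐ A ≈ id
    λ-isoʳ : ∀ {A} → λ⇐ A ⨾ λ⇒ A ≈ id
    ρ-isoˡ : ∀ {A} → ρ⇒ A ⨾ ρ⇐ A ≈ id
    ρ-isoʳ : ∀ {A} → ρ⇐ A ⨾ ρ⇒ A ≈ id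
    α-isoˡ : ∀ {A B C} → α⇒ A B C ⨾ α⇐ A B C ≈ id
    α-isoʳ : ∀ {A B C} → α⇐ A B C ⨾ α⇒ A B C ≈ id
    β-iso  : ∀ {A B} → β A B ⨾ β B A ≈ id

    λ-natural : ∀ {A B} (f : A ⇒ B) → (id ⊕₁ f) ⨾ λ⇒ B ≈ λ⇒ A ⨾ f
    ρ-natural : ∀ {A B} (f : A ⇒ B) → (f ⊕₁ id) ⨾ ρ⇒ B ≈ ρ⇒ A ⨾ f
    α-natural : ∀ {A B C A′ B′ C′} (f : A ⇒ A′) (g : B ⇒ B′) (h : C ⇒ C′) →
                ((f ⊕₁ g) ⊕₁ h) ⨾ α⇒ A′ B′ C′ ≈ α⇒ A B C ⨾ (f ⊕₁ (g ⊕₁ h))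
    β-natural : ∀ {A B A′ B′} (f : A ⇒ A′) (g : B ⇒ B′) →
                (f ⊕₁ g) ⨾ β A′ B′ ≈ β A B ⨾ (g ⊕₁ f)

    triangle : ∀ {A B} → α⇒ A ⊥ B ⨾ (id ⊕₁ λ⇒ B) ≈ ρ⇒ A ⊕₁ id
    pentagon : ∀ {A B C D} →
               (α⇒ A B C ⊕₁ id) ⨾ α⇒ A (B ⊕₀ C) D ⨾ (id ⊕₁ α⇒ B C D)
                 ≈ α⇒ (A ⊕₀ B) C D ⨾ α⇒ A B (C ⊕₀ D)
    hexagon  : ∀ {A B C} →
               α⇒ A B C ⨾ β A (B ⊕₀ C) ⨾ α⇒ B C A
                 ≈ (β A B ⊕₁ id) ⨾ α⇒ B A C ⨾ (id ⊕₁ β A C)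

  -⊕_ : Obj → Functor U U
  -⊕ B = record
    { F₀       = λ A → A ⊕₀ B
    ; F₁       = λ f → f ⊕₁ id
    ; F-resp-≈ = λ p → ⊕-resp-≈ p Equiv.refl
    ; F-id     = ⊕-id
    ; F-⨾      = Equiv.trans (⊕-resp-≈ Equiv.refl (Equiv.sym idˡ)) ⊕-⨾ }

  -- The canonical isomorphism (A ⊕ B) ⊕ (C ⊕ D) ≅ (A ⊕ C) ⊕ (B ⊕ D).
  interchange : ∀ A B C D → (A ⊕₀ B) ⊕₀ (C ⊕₀ D) ⇒ (A ⊕₀ C) ⊕₀ (B ⊕₀ D)
  interchange A B C D =
    α⇒ A B (C ⊕₀ D) ⨾ (id ⊕₁ (α⇐ B C D ⨾ (β B C ⊕₁ id) ⨾ α⇒ C B D)) ⨾ α⇐ A C (B ⊕₀ D)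

record Coclosed {o ℓ e} (M : SymmetricMonoidalCategory o ℓ e) : Set (o ⊔ ℓ ⊔ e) where
  open SymmetricMonoidalCategory M
  field
    -•─_     : Obj → Functor U U
    coclosed : ∀ B → Adjunction (-•─ B) (-⊕ B)

record SymmetricMonoidalCoclosedCategory (o ℓ e : Level) : Set (suc (o ⊔ ℓ ⊔ e)) where
  field
    smc      : SymmetricMonoidalCategory o ℓ e
    coclosed : Coclosed smc
  open SymmetricMonoidalCategory smc public

------------------------------------------------------------------------
-- Cocartesian categories

record CocartesianCategory (o ℓ e : Level) : Set (suc (o ⊔ ℓ ⊔ e)) where
  infixr 10 _+_
  field
    U : Category o ℓ e
  open Category U public
  field
    𝟘        : Obj
    ¡        : ∀ {A} → 𝟘 ⇒ A
    ¡-unique : ∀ {A} (f : 𝟘 ⇒ A) → ¡ ≈ f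

    _+_       : Obj → Obj → Obj
    i₁        : ∀ {A B} → A ⇒ A + B
    i₂        : ∀ {A B} → B ⇒ A + B
    [_,_]     : ∀ {A B C} → A ⇒ C → B ⇒ C → A + B ⇒ C
    i₁-[]     : ∀ {A B C} {f : A ⇒ C} {g : B ⇒ C} → i₁ ⨾ [ f , g ] ≈ f
    i₂-[]     : ∀ {A B C} {f : A ⇒ C} {g : B ⇒ C} → i₂ ⨾ [ f , g ] ≈ g
    []-unique : ∀ {A B C} {f : A ⇒ C} {g : B ⇒ C} {h : A + B ⇒ C} →
                i₁ ⨾ h ≈ f → i₂ ⨾ h ≈ g → [ f , g ] ≈ h

module _ {o ℓ e} (𝓒 : CocartesianCategory o ℓ e) where
  open CocartesianCategory 𝓒
  open Equiv
  private
    infixr 10 _+₁_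
    _+₁_ : ∀ {A B C D} → A ⇒ B → C ⇒ D → A + C ⇒ B + D
    f +₁ g = [ f ⨾ i₁ , g ⨾ i₂ ]

    []-cong : ∀ {A B C} {f f′ : A ⇒ C} {g g′ : B ⇒ C} →
              f ≈ f′ → g ≈ g′ → [ f , g ] ≈ [ f′ , g′ ]
    []-cong p q = []-unique (trans i₁-[] (sym p)) (trans i₂-[] (sym q))

    []-⨾ : ∀ {A B C D} {f : A ⇒ C} {g : B ⇒ C} {h : C ⇒ D} →
           [ f , g ] ⨾ h ≈ [ f ⨾ h , g ⨾ h ]
    []-⨾ = sym ([]-unique (pullˡ i₁-[]) (pullˡ i₂-[]))

    []-η : ∀ {A B} → [ i₁ , i₂ ] ≈ id {A + B}
    []-η = []-unique idʳ idʳ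

    +₁-[] : ∀ {A B C D E} {f : A ⇒ B} {g : C ⇒ D} {h : B ⇒ E} {k : D ⇒ E} →
            (f +₁ g) ⨾ [ h , k ] ≈ [ f ⨾ h , g ⨾ k ]
    +₁-[] = trans []-⨾ ([]-cong (trans assoc (refl ⟨⨾⟩ i₁-[])) (trans assoc (refl ⟨⨾⟩ i₂-[])))

    ¡-unique₂ : ∀ {A} {f g : 𝟘 ⇒ A} → f ≈ g
    ¡-unique₂ {f = f} {g} = trans (sym (¡-unique f)) (¡-unique g)

    +-α : ∀ A B C → (A + B) + C ⇒ A + (B + C)
    +-α A B C = [ [ i₁ , i₁ ⨾ i₂ ] , i₂ ⨾ i₂ ]

    +-α⁻¹ : ∀ A B C → A + (B + C) ⇒ (A + B) + C
    +-α⁻¹ A B C = [ i₁ ⨾ i₁ , [ i₂ ⨾ i₁ , i₂ ] ]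

    α-[] : ∀ {A B C D} {f : A ⇒ D} {g : B ⇒ D} {h : C ⇒ D} →
           +-α A B C ⨾ [ f , [ g , h ] ] ≈ [ [ f , g ] , h ]
    α-[] = trans []-⨾ ([]-cong
      (trans []-⨾ ([]-cong i₁-[] (trans assoc (trans (refl ⟨⨾⟩ i₂-[]) i₁-[]))))
      (trans assoc (trans (refl ⟨⨾⟩ i₂-[]) i₂-[])))

    α⁻¹-[] : ∀ {A B C D} {f : A ⇒ D} {g : B ⇒ D} {h : C ⇒ D} →
             +-α⁻¹ A B C ⨾ [ [ f , g ] , h ] ≈ [ f , [ g , h ] ]
    α⁻¹-[] = trans []-⨾ ([]-cong
      (trans assoc (trans (refl ⟨⨾⟩ i₁-[]) i₁-[]))
      (trans []-⨾ ([]-cong (trans assoc (trans (refl ⟨⨾⟩ i₁-[]) i₂-[])) i₂-[])))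

    split : ∀ {A B C} {h : A + B ⇒ C} → h ≈ [ i₁ ⨾ h , i₂ ⨾ h ]
    split = sym ([]-unique refl refl)

    splitʳ : ∀ {A B C D} {h : A + (B + C) ⇒ D} →
             h ≈ [ i₁ ⨾ h , [ i₁ ⨾ (i₂ ⨾ h) , i₂ ⨾ (i₂ ⨾ h) ] ]
    splitʳ = trans split ([]-cong refl split)

    α-⨾ : ∀ {A B C D} {h : A + (B + C) ⇒ D} →
          +-α A B C ⨾ h ≈ [ [ i₁ ⨾ h , i₁ ⨾ (i₂ ⨾ h) ] , i₂ ⨾ (i₂ ⨾ h) ]
    α-⨾ = trans (refl ⟨⨾⟩ splitʳ) α-[]

    i₁i₂-[] : ∀ {A B C D E} {f : A ⇒ E} {g : B ⇒ D} {h : C ⇒ D} {k : D ⇒ E} →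
              (i₁ ⨾ i₂) ⨾ [ f , [ g , h ] ⨾ k ] ≈ g ⨾ k
    i₁i₂-[] = trans assoc (trans (refl ⟨⨾⟩ i₂-[]) (pullˡ i₁-[]))

  cocartesianSMC : SymmetricMonoidalCategory o ℓ e
  cocartesianSMC = record
    { U         = U
    ; ⊥         = 𝟘
    ; _⊕₀_      = _+_
    ; _⊕₁_      = _+₁_
    ; ⊕-resp-≈  = λ p q → []-cong (p ⟨⨾⟩ refl) (q ⟨⨾⟩ refl)
    ; ⊕-id      = trans ([]-cong idˡ idˡ) []-η
    ; ⊕-⨾       = sym (trans +₁-[] ([]-cong (sym assoc) (sym assoc)))
    ; λ⇒        = λ _ → [ ¡ , id ]
    ; λ⇐        = λ _ → i₂
    ; ρ⇒        = λ _ → [ id , ¡ ]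
    ; ρ⇐        = λ _ → i₁
    ; α⇒        = +-α
    ; α⇐        = +-α⁻¹
    ; β         = λ _ _ → [ i₂ , i₁ ]
    ; λ-isoˡ    = trans []-⨾ (trans ([]-cong ¡-unique₂ idˡ) []-η)
    ; λ-isoʳ    = i₂-[]
    ; ρ-isoˡ    = trans []-⨾ (trans ([]-cong idˡ ¡-unique₂) []-η)
    ; ρ-isoʳ    = i₁-[]
    ; α-isoˡ    = trans α-[] (trans ([]-cong (trans (sym []-⨾) (trans ([]-η ⟨⨾⟩ refl) idˡ)) refl) []-η)
    ; α-isoʳ    = trans α⁻¹-[] (trans ([]-cong refl (trans (sym []-⨾) (trans ([]-η ⟨⨾⟩ refl) idˡ))) []-η)
    ; β-iso     = trans []-⨾ (trans ([]-cong i₂-[] i₁-[]) []-η)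
    ; λ-natural = λ f → trans +₁-[] (trans ([]-cong ¡-unique₂ (trans idʳ (sym idˡ))) (sym []-⨾))
    ; ρ-natural = λ f → trans +₁-[] (trans ([]-cong (trans idʳ (sym idˡ)) ¡-unique₂) (sym []-⨾))
    ; α-natural = λ f g h → trans +₁-[] (trans ([]-cong
        (trans +₁-[] ([]-cong (sym i₁-[])
          (sym (trans (refl ⟨⨾⟩ i₂-[]) (trans (pullˡ i₁-[]) assoc)))))
        (sym (trans (refl ⟨⨾⟩ i₂-[]) (trans (pullˡ i₂-[]) assoc))))
        (sym α-⨾))
    ; β-natural = λ f g → trans +₁-[] (sym (trans []-⨾ ([]-cong i₂-[] i₁-[])))
    ; triangle  = trans α-⨾ ([]-cong
        (trans ([]-cong i₁-[] (trans (refl ⟨⨾⟩ i₂-[]) (trans (pullˡ i₁-[]) ¡-unique₂))) (sym []-⨾))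
        (trans (refl ⟨⨾⟩ i₂-[]) (pullˡ i₂-[])))
    ; pentagon  = trans
        (trans (trans +₁-[] ([]-cong
          (trans α-⨾ ([]-cong ([]-cong i₁-[] (refl ⟨⨾⟩ i₂-[])) (refl ⟨⨾⟩ i₂-[]))) idˡ) ⟨⨾⟩ refl)
        (trans []-⨾ ([]-cong
          (trans []-⨾ ([]-cong
            (trans []-⨾ ([]-cong
              (trans i₁-[] idˡ)
              (trans assoc (trans (refl ⟨⨾⟩ i₁i₂-[]) (pullˡ i₁-[])))))
            (trans assoc (trans (refl ⟨⨾⟩ i₁i₂-[]) (trans (pullˡ i₂-[]) assoc)))))
          (trans assoc (trans (refl ⟨⨾⟩ i₂-[]) (trans (pullˡ i₂-[]) assoc))))))
        (sym (trans α-⨾ ([]-cong ([]-cong i₁-[] (refl ⟨⨾⟩ i₂-[])) (refl ⟨⨾⟩ i₂-[]))))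
    ; hexagon   = trans
        (trans (trans α-⨾ ([]-cong ([]-cong i₁-[] (refl ⟨⨾⟩ i₂-[])) (refl ⟨⨾⟩ i₂-[])) ⟨⨾⟩ refl)
        (trans []-⨾ ([]-cong
          (trans []-⨾ ([]-cong i₂-[] (trans assoc (trans (refl ⟨⨾⟩ i₁-[]) i₁-[]))))
          (trans assoc (trans (refl ⟨⨾⟩ i₁-[]) i₂-[])))))
        (sym (trans (trans +₁-[] ([]-cong (trans []-⨾ ([]-cong i₂-[] i₁-[])) idˡ) ⟨⨾⟩ refl)
        (trans []-⨾ ([]-cong
          (trans []-⨾ ([]-cong
            (trans assoc (trans (refl ⟨⨾⟩ i₂-[]) (pullˡ i₁-[])))
            (trans i₁-[] idˡ)))
          (trans assoc (trans (refl ⟨⨾⟩ i₂-[]) (pullˡ i₂-[])))))))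
    }

record CocartesianCoclosedCategory (o ℓ e : Level) : Set (suc (o ⊔ ℓ ⊔ e)) where
  field
    cocartesian : CocartesianCategory o ℓ e
  smc : SymmetricMonoidalCategory o ℓ e
  smc = cocartesianSMC cocartesian
  field
    coclosed : Coclosed smc

------------------------------------------------------------------------
-- Symmetric comonoidal functors and transformations

-- Structure maps are separated from their laws: the conditions on a comonoidal
-- transformation mention only the maps, and composites can be written down
-- without first proving that they satisfy the laws.

module _ {o ℓ e o′ ℓ′ e′}
         (M : SymmetricMonoidalCategory o ℓ e) (N : SymmetricMonoidalCategory o′ ℓ′ e′) where
  private
    module M = SymmetricMonoidalCategory M
    module N = SymmetricMonoidalCategory N

  record ComonoidalMaps (F : Functor M.U N.U) : Set (o ⊔ ℓ′) where
    open Functor F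
    open M using (_⊕₀_)
    field
      m⊥ : F₀ M.⊥ N.⇒ N.⊥
      m  : ∀ A B → F₀ (A ⊕₀ B) N.⇒ F₀ A N.⊕₀ F₀ B

  record IsSymmetricComonoidal {F : Functor M.U N.U} (maps : ComonoidalMaps F)
         : Set (o ⊔ ℓ ⊔ ℓ′ ⊔ e′) where
    open Functor F
    open ComonoidalMaps maps
    open N using (_≈_; _⨾_; _⊕₁_; id)
    field
      m-natural : ∀ {A B A′ B′} (f : A M.⇒ A′) (g : B M.⇒ B′) →
                  F₁ (f M.⊕₁ g) ⨾ m A′ B′ ≈ m A B ⨾ (F₁ f ⊕₁ F₁ g)
      m-assoc   : ∀ A B C →
                  m (A M.⊕₀ B) C ⨾ (m A B ⊕₁ id) ⨾ N.α⇒ (F₀ A) (F₀ B) (F₀ C)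
                    ≈ F₁ (M.α⇒ A B C) ⨾ m A (B M.⊕₀ C) ⨾ (id ⊕₁ m B C)
      m-unitˡ   : ∀ A → m M.⊥ A ⨾ (m⊥ ⊕₁ id) ≈ F₁ (M.λ⇒ A) ⨾ N.λ⇐ (F₀ A)
      m-unitʳ   : ∀ A → m A M.⊥ ⨾ (id ⊕₁ m⊥) ≈ F₁ (M.ρ⇒ A) ⨾ N.ρ⇐ (F₀ A)
      m-sym     : ∀ A B → m A B ⨾ N.β (F₀ A) (F₀ B) ≈ F₁ (M.β A B) ⨾ m B A

  record SymmetricComonoidalFunctor : Set (o ⊔ ℓ ⊔ e ⊔ o′ ⊔ ℓ′ ⊔ e′) where
    field
      functor               : Functor M.U N.U
      maps                  : ComonoidalMaps functor
      isSymmetricComonoidal : IsSymmetricComonoidal maps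

  record IsComonoidalTransformation {F G : Functor M.U N.U}
         (mF : ComonoidalMaps F) (mG : ComonoidalMaps G)
         (φ : NaturalTransformation F G) : Set (o ⊔ e′) where
    open ComonoidalMaps mF
    open ComonoidalMaps mG renaming (m⊥ to n⊥; m to n)
    open NaturalTransformation φ using () renaming (η to f)
    open N using (_≈_; _⨾_; _⊕₁_)
    field
      preserves-m  : ∀ A B → m A B ⨾ (f A ⊕₁ f B) ≈ f (A M.⊕₀ B) ⨾ n A B
      preserves-m⊥ : f M.⊥ ⨾ n⊥ ≈ m⊥

idMaps : ∀ {o ℓ e} (M : SymmetricMonoidalCategory o ℓ e) → ComonoidalMaps M M idF
idMaps M = record { m⊥ = id ; m = λ _ _ → id }
  where open SymmetricMonoidalCategory M

module _ {o ℓ e o′ ℓ′ e′ o″ ℓ″ e″}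
         (M : SymmetricMonoidalCategory o ℓ e)
         (N : SymmetricMonoidalCategory o′ ℓ′ e′)
         (P : SymmetricMonoidalCategory o″ ℓ″ e″) where
  private
    module M = SymmetricMonoidalCategory M
    module N = SymmetricMonoidalCategory N
    module P = SymmetricMonoidalCategory P

  compMaps : {F : Functor M.U N.U} {G : Functor N.U P.U} →
             ComonoidalMaps M N F → ComonoidalMaps N P G → ComonoidalMaps M P (F ⨾F G)
  compMaps {F} {G} mF mG = record
    { m⊥ = G.F₁ mF.m⊥ P.⨾ mG.m⊥
    ; m  = λ A B → G.F₁ (mF.m A B) P.⨾ mG.m (F.F₀ A) (F.F₀ B) }
    where
      module F = Functor F
      module G = Functor G
      module mF = ComonoidalMaps mF
      module mG = ComonoidalMaps mG

record SymmetricComonoidalAdjunction {o ℓ e o′ ℓ′ e′}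
       (M : SymmetricMonoidalCategory o ℓ e) (N : SymmetricMonoidalCategory o′ ℓ′ e′)
       : Set (o ⊔ ℓ ⊔ e ⊔ o′ ⊔ ℓ′ ⊔ e′) where
  field
    left  : SymmetricComonoidalFunctor M N
    right : SymmetricComonoidalFunctor N M
  module left  = SymmetricComonoidalFunctor left
  module right = SymmetricComonoidalFunctor right
  field
    adjunction : Adjunction left.functor right.functor
  open Adjunction adjunction public using (unit; counit; zig; zag)
  field
    unit-comonoidal   : IsComonoidalTransformation M M
                          (idMaps M) (compMaps M N M left.maps right.maps) unit
    counit-comonoidal : IsComonoidalTransformation N N
                          (compMaps N M N right.maps left.maps) (idMaps N) counit

record DualLNLModel (o ℓ e o′ ℓ′ e′ : Level)
       : Set (suc (o ⊔ ℓ ⊔ e ⊔ o′ ⊔ ℓ′ ⊔ e′)) where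
  field
    𝓛 : SymmetricMonoidalCoclosedCategory o ℓ e
    𝓒 : CocartesianCoclosedCategory o′ ℓ′ e′
  module 𝓛 = SymmetricMonoidalCoclosedCategory 𝓛
  module 𝓒 = CocartesianCoclosedCategory 𝓒
  field
    H⊣J : SymmetricComonoidalAdjunction 𝓛.smc 𝓒.smc

------------------------------------------------------------------------
-- Symmetric comonoidal monads

record ComonoidalMonadData {o ℓ e} (M : SymmetricMonoidalCategory o ℓ e)
       : Set (o ⊔ ℓ ⊔ e) where
  open SymmetricMonoidalCategory M
  field
    T    : Functor U U
    maps : ComonoidalMaps M M T
    unit : NaturalTransformation idF T
    mult : NaturalTransformation (T ⨾F T) T
  open Functor T public renaming (F₀ to T₀; F₁ to T₁)
  open ComonoidalMaps maps public renaming (m⊥ to r⊥; m to r)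
  open NaturalTransformation unit public using (η)
  open NaturalTransformation mult public using () renaming (η to μ)

record IsSymmetricComonoidalMonad {o ℓ e} (M : SymmetricMonoidalCategory o ℓ e)
       (𝕋 : ComonoidalMonadData M) : Set (o ⊔ ℓ ⊔ e) where
  open SymmetricMonoidalCategory M
  open ComonoidalMonadData 𝕋
  field
    isSymmetricComonoidal : IsSymmetricComonoidal M M maps
    unit-comonoidal       : IsComonoidalTransformation M M (idMaps M) maps unit
    mult-comonoidal       : IsComonoidalTransformation M M (compMaps M M M maps maps) maps mult
    μ-identityˡ           : ∀ A → η (T₀ A) ⨾ μ A ≈ id
    μ-identityʳ           : ∀ A → T₁ (η A) ⨾ μ A ≈ id
    μ-assoc               : ∀ A → μ (T₀ A) ⨾ μ A ≈ T₁ (μ A) ⨾ μ A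

module _ {o ℓ e} (M : SymmetricMonoidalCategory o ℓ e) where
  open SymmetricMonoidalCategory M

  record IsCommutativeMonoid (A : Obj) (w : ⊥ ⇒ A) (c : A ⊕₀ A ⇒ A) : Set e where
    field
      c-assoc : (c ⊕₁ id) ⨾ c ≈ α⇒ A A A ⨾ (id ⊕₁ c) ⨾ c
      c-unitˡ : (w ⊕₁ id) ⨾ c ≈ λ⇒ A
      c-unitʳ : (id ⊕₁ w) ⨾ c ≈ ρ⇒ A
      c-comm  : β A A ⨾ c ≈ c

  module _ (𝕋 : ComonoidalMonadData M) where
    open ComonoidalMonadData 𝕋

    IsAlgebraMorphism : ∀ {X Y} → T₀ X ⇒ X → T₀ Y ⇒ Y → X ⇒ Y → Set e
    IsAlgebraMorphism a b f = T₁ f ⨾ b ≈ a ⨾ f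

    T⊕T : Functor U U
    T⊕T = record
      { F₀       = λ A → T₀ A ⊕₀ T₀ A
      ; F₁       = λ f → T₁ f ⊕₁ T₁ f
      ; F-resp-≈ = λ p → ⊕-resp-≈ (F-resp-≈ p) (F-resp-≈ p)
      ; F-id     = Equiv.trans (⊕-resp-≈ F-id F-id) ⊕-id
      ; F-⨾      = Equiv.trans (⊕-resp-≈ F-⨾ F-⨾) ⊕-⨾ }

    T⊕T-maps : ComonoidalMaps M M T⊕T
    T⊕T-maps = record
      { m⊥ = (r⊥ ⊕₁ r⊥) ⨾ λ⇒ ⊥
      ; m  = λ A B → (r A B ⊕₁ r A B) ⨾ interchange (T₀ A) (T₀ B) (T₀ A) (T₀ B) }

    const⊥-maps : ComonoidalMaps M M (constF ⊥)
    const⊥-maps = record { m⊥ = id ; m = λ _ _ → ρ⇐ ⊥ }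

------------------------------------------------------------------------
-- Dual linear categories

record DualLinearStructure {o ℓ e} (𝓛 : SymmetricMonoidalCoclosedCategory o ℓ e)
       (𝕋 : ComonoidalMonadData (SymmetricMonoidalCoclosedCategory.smc 𝓛))
       : Set (o ⊔ ℓ ⊔ e) where
  open SymmetricMonoidalCoclosedCategory 𝓛
  open ComonoidalMonadData 𝕋 renaming (T₀ to ?₀)
  field
    isSymmetricComonoidalMonad : IsSymmetricComonoidalMonad smc 𝕋

    weakening   : NaturalTransformation (constF ⊥) T
    contraction : NaturalTransformation (T⊕T smc 𝕋) T

  open NaturalTransformation weakening public using () renaming (η to w)
  open NaturalTransformation contraction public using () renaming (η to c)

  field
    w-comonoidal : IsComonoidalTransformation smc smc (const⊥-maps smc 𝕋) maps weakening
    c-comonoidal : IsComonoidalTransformation smc smc (T⊕T-maps smc 𝕋) maps contraction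

    isCommutativeMonoid : ∀ A → IsCommutativeMonoid smc (?₀ A) (w A) (c A)

    w-algebraMorphism : ∀ A → IsAlgebraMorphism smc 𝕋 r⊥ (μ A) (w A)
    c-algebraMorphism : ∀ A →
      IsAlgebraMorphism smc 𝕋 (r (?₀ A) (?₀ A) ⨾ (μ A ⊕₁ μ A)) (μ A) (c A)

    algebraMorphism⇒monoidMorphism : ∀ {A B} (f : ?₀ A ⇒ ?₀ B) →
      IsAlgebraMorphism smc 𝕋 (μ A) (μ B) f →
      (w A ⨾ f ≈ w B) × (c A ⨾ f ≈ (f ⊕₁ f) ⨾ c B)

record DualLinearCategory (o ℓ e : Level) : Set (suc (o ⊔ ℓ ⊔ e)) where
  field
    𝓛         : SymmetricMonoidalCoclosedCategory o ℓ e
    𝕋         : ComonoidalMonadData (SymmetricMonoidalCoclosedCategory.smc 𝓛)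
    structure : DualLinearStructure 𝓛 𝕋

module _ {o ℓ e o′ ℓ′ e′} (𝓜 : DualLNLModel o ℓ e o′ ℓ′ e′) where
  open DualLNLModel 𝓜
  open SymmetricComonoidalAdjunction H⊣J
  private
    module H = Functor left.functor
    module J = Functor right.functor
    module ε = NaturalTransformation counit
    open 𝓛 using (module Equiv)

  inducedMonad : ComonoidalMonadData 𝓛.smc
  inducedMonad = record
    { T    = left.functor ⨾F right.functor
    ; maps = compMaps 𝓛.smc 𝓒.smc 𝓛.smc left.maps right.maps
    ; unit = unit
    ; mult = record
        { η       = λ A → J.F₁ (ε.η (H.F₀ A))
        ; natural = λ f → Equiv.trans (Equiv.sym J.F-⨾)
                            (Equiv.trans (J.F-resp-≈ (ε.natural (H.F₁ f))) J.F-⨾) } }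

{-# OPTIONS --safe #-}

-- The right adjoint of a comonoidal adjunction is strong: the mate of h ⨾ (ε + ε)
-- inverts j : J (R + S) ⇒ J R ⊕ J S.  Hence J carries the canonical commutative
-- monoid (R , ¡ , ∇) of a cocartesian category to a commutative monoid on J R, and
-- every J g to a monoid morphism.  A morphism f of free algebras need not be of the
-- form J g, but μ ⨾ f is, and f inherits the property because μ is a split
-- epimorphism and itself a monoid morphism.

module Submission where

open import Defs
open import Data.Product.Base using (∃; _,_)
open import Level using (_⊔_)

-- Split epimorphisms.

module Sections {o ℓ e} (𝓒 : Category o ℓ e) where
  open Category 𝓒
  open Equiv
  open HomReasoning

  pullʳ : ∀ {A B C D} {f : A ⇒ B} {g : B ⇒ C} {h : C ⇒ D} {k : B ⇒ D} →
          g ⨾ h ≈ k → (f ⨾ g) ⨾ h ≈ f ⨾ k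
  pullʳ p = trans assoc (refl ⟨⨾⟩ p)

  cancelˡ : ∀ {A B C} {f : A ⇒ B} {g : B ⇒ A} {h : A ⇒ C} → f ⨾ g ≈ id → f ⨾ (g ⨾ h) ≈ h
  cancelˡ p = trans (pullˡ p) idˡ

  cancelʳ : ∀ {A B C} {h : A ⇒ B} {f : B ⇒ C} {g : C ⇒ B} → f ⨾ g ≈ id → (h ⨾ f) ⨾ g ≈ h
  cancelʳ p = trans (pullʳ p) idʳ

  -- In diagrammatic order this makes `p` a split epimorphism, which can be cancelled on the left of
  -- a composite.
  HasSection : ∀ {A B} → A ⇒ B → Set (ℓ ⊔ e)
  HasSection {A} {B} p = ∃ λ (s : B ⇒ A) → s ⨾ p ≈ id

  id-section : ∀ {A} → HasSection (id {A})
  id-section = id , idˡ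

  ⨾-section : ∀ {A B C} {p : A ⇒ B} {q : B ⇒ C} →
              HasSection p → HasSection q → HasSection (p ⨾ q)
  ⨾-section (s , sp) (t , tq) = t ⨾ s , trans (pullʳ (cancelˡ sp)) tq

  section-cancel : ∀ {A B C} {p : A ⇒ B} {f g : B ⇒ C} →
                   HasSection p → p ⨾ f ≈ p ⨾ g → f ≈ g
  section-cancel (s , sp) eq =
    trans (sym (cancelˡ sp)) (trans (refl ⟨⨾⟩ eq) (cancelˡ sp))

-- Codiagonals and structural isomorphisms of coproducts.

module Coproducts {o ℓ e} (𝓒 : CocartesianCategory o ℓ e) where
  open CocartesianCategory 𝓒
  open SymmetricMonoidalCategory (cocartesianSMC 𝓒)
    using (_⊕₁_; α⇒; α⇐; β; λ⇒; ρ⇒; ρ⇐; interchange)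
  open Equiv
  open Sections U

  ∇ : ∀ {A} → A + A ⇒ A
  ∇ = [ id , id ]

  ¡-unique₂ : ∀ {A} {f g : 𝟘 ⇒ A} → f ≈ g
  ¡-unique₂ {f = f} {g} = trans (sym (¡-unique f)) (¡-unique g)

  []-cong : ∀ {A B C} {f f′ : A ⇒ C} {g g′ : B ⇒ C} →
            f ≈ f′ → g ≈ g′ → [ f , g ] ≈ [ f′ , g′ ]
  []-cong p q = []-unique (trans i₁-[] (sym p)) (trans i₂-[] (sym q))

  []-⨾ : ∀ {A B C D} {f : A ⇒ C} {g : B ⇒ C} {h : C ⇒ D} →
         [ f , g ] ⨾ h ≈ [ f ⨾ h , g ⨾ h ]
  []-⨾ = sym ([]-unique (pullˡ i₁-[]) (pullˡ i₂-[]))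

  []-η : ∀ {A B} → [ i₁ , i₂ ] ≈ id {A + B}
  []-η = []-unique idʳ idʳ

  ⊕-[] : ∀ {A B C D E} {f : A ⇒ B} {g : C ⇒ D} {h : B ⇒ E} {k : D ⇒ E} →
         (f ⊕₁ g) ⨾ [ h , k ] ≈ [ f ⨾ h , g ⨾ k ]
  ⊕-[] = trans []-⨾ ([]-cong (pullʳ i₁-[]) (pullʳ i₂-[]))

  α-[] : ∀ {A B C D} {f : A ⇒ D} {g : B ⇒ D} {h : C ⇒ D} →
         α⇒ A B C ⨾ [ f , [ g , h ] ] ≈ [ [ f , g ] , h ]
  α-[] = trans []-⨾ ([]-cong
    (trans []-⨾ ([]-cong i₁-[] (trans (pullʳ i₂-[]) i₁-[])))
    (trans (pullʳ i₂-[]) i₂-[]))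

  α⁻¹-[] : ∀ {A B C D} {f : A ⇒ D} {g : B ⇒ D} {h : C ⇒ D} →
           α⇐ A B C ⨾ [ [ f , g ] , h ] ≈ [ f , [ g , h ] ]
  α⁻¹-[] = trans []-⨾ ([]-cong
    (trans (pullʳ i₁-[]) i₁-[])
    (trans []-⨾ ([]-cong (trans (pullʳ i₁-[]) i₂-[]) i₂-[])))

  β-[] : ∀ {A B C} {f : A ⇒ C} {g : B ⇒ C} → β B A ⨾ [ f , g ] ≈ [ g , f ]
  β-[] = trans []-⨾ ([]-cong i₂-[] i₁-[])

  -- Structural maps between coproducts are determined by their action on copairings. The
  -- associators and the symmetry inside `interchange` rebracket the four components and swap the
  -- middle two.
  interchange-[] : ∀ {A B C D E} {f : A ⇒ E} {g : B ⇒ E} {h : C ⇒ E} {k : D ⇒ E} →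
                   interchange A B C D ⨾ [ [ f , h ] , [ g , k ] ] ≈ [ [ f , g ] , [ h , k ] ]
  interchange-[] =
    trans (pullʳ α⁻¹-[])
    (trans (pullʳ (trans ⊕-[] ([]-cong idˡ
      (trans (pullʳ α-[]) (trans (pullʳ (trans ⊕-[] ([]-cong β-[] idˡ))) α⁻¹-[])))))
    α-[])

  ∇-⨾ : ∀ {A B} {f : A ⇒ B} → ∇ ⨾ f ≈ (f ⊕₁ f) ⨾ ∇
  ∇-⨾ = trans (trans []-⨾ ([]-cong (trans idˡ (sym idʳ)) (trans idˡ (sym idʳ)))) (sym ⊕-[])

  ∇-assoc : ∀ {A} → (∇ ⊕₁ id) ⨾ ∇ ≈ α⇒ A A A ⨾ (id ⊕₁ ∇) ⨾ ∇
  ∇-assoc = trans (trans ⊕-[] ([]-cong idʳ idˡ))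
    (sym (trans (pullʳ (trans ⊕-[] ([]-cong idˡ idʳ))) α-[]))

  ∇-unitˡ : ∀ {A} → (¡ ⊕₁ id) ⨾ ∇ ≈ λ⇒ A
  ∇-unitˡ = trans ⊕-[] ([]-cong idʳ idˡ)

  ∇-unitʳ : ∀ {A} → (id ⊕₁ ¡) ⨾ ∇ ≈ ρ⇒ A
  ∇-unitʳ = trans ⊕-[] ([]-cong idˡ idʳ)

  ∇-𝟘 : ∇ ≈ λ⇒ 𝟘
  ∇-𝟘 = []-cong ¡-unique₂ refl

  -- The map `∇ ⊕₁ ∇` is `[ [ i₁ , i₁ ] , [ i₂ , i₂ ] ]`; interchanging turns it into two copies of
  -- `[ i₁ , i₂ ]`, which is the identity. This is the source of comonoidality of contraction.
  ∇-⊕ : ∀ {A B} → interchange A B A B ⨾ (∇ ⊕₁ ∇) ≈ ∇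
  ∇-⊕ = trans (refl ⟨⨾⟩ []-cong (trans []-⨾ ([]-cong idˡ idˡ)) (trans []-⨾ ([]-cong idˡ idˡ)))
    (trans interchange-[] ([]-cong []-η []-η))

-- Tensor products of composites and of split epimorphisms.

module Tensor {o ℓ e} (M : SymmetricMonoidalCategory o ℓ e) where
  open SymmetricMonoidalCategory M
  open Equiv
  open Sections U

  ⊕-⨾ˡ : ∀ {A B C D E} {f : A ⇒ B} {g : B ⇒ C} {h : D ⇒ E} →
         (f ⨾ g) ⊕₁ h ≈ (f ⊕₁ id) ⨾ (g ⊕₁ h)
  ⊕-⨾ˡ = trans (⊕-resp-≈ refl (sym idˡ)) ⊕-⨾

  ⊕-⨾ʳ : ∀ {A B C D E} {f : A ⇒ B} {g : B ⇒ C} {h : D ⇒ E} →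
         h ⊕₁ (f ⨾ g) ≈ (id ⊕₁ f) ⨾ (h ⊕₁ g)
  ⊕-⨾ʳ = trans (⊕-resp-≈ (sym idˡ) refl) ⊕-⨾

  ⊕-section : ∀ {A B C D} {p : A ⇒ B} {q : C ⇒ D} →
              HasSection p → HasSection q → HasSection (p ⊕₁ q)
  ⊕-section (s , sp) (t , tq) = s ⊕₁ t , trans (sym ⊕-⨾) (trans (⊕-resp-≈ sp tq) ⊕-id)

-- Coherence of symmetric comonoidal functors.

-- A calculus of squares F f ⨾ q ≈ p ⨾ f̂, in which the coherence of F with a
-- composite of structural isomorphisms is obtained by following its construction.
module Squares {o ℓ e o′ ℓ′ e′}
  (M : SymmetricMonoidalCategory o ℓ e) (N : SymmetricMonoidalCategory o′ ℓ′ e′)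
  {F : Functor (SymmetricMonoidalCategory.U M) (SymmetricMonoidalCategory.U N)}
  {maps : ComonoidalMaps M N F} (isSC : IsSymmetricComonoidal M N maps) where
  private module M = SymmetricMonoidalCategory M
  open SymmetricMonoidalCategory N
  open Equiv
  open Functor F
  open ComonoidalMaps maps
  open IsSymmetricComonoidal isSC
  open Sections U
  open Tensor N
  open HomReasoning

  infixr 10 _⊗_ _⊗□_
  infixl 7 _⟫_

  -- Legs are bracketed like the objects they start from, so nested uses with identity legs are the
  -- iterated comonoidal maps.
  _⊗_ : ∀ {A B X Y} → F₀ A ⇒ X → F₀ B ⇒ Y → F₀ (A M.⊕₀ B) ⇒ X ⊕₀ Y
  p ⊗ q = m _ _ ⨾ (p ⊕₁ q)

  id⊗id : ∀ {A B} → id ⊗ id ≈ m A B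
  id⊗id = trans (refl ⟨⨾⟩ ⊕-id) idʳ

  -- The map `f̂` need not be an image under `F`; this freedom allows unit and multiplication maps
  -- of monoids to sit over `¡` and `∇`.
  Square : ∀ {A B X Y} → F₀ A ⇒ X → F₀ B ⇒ Y → A M.⇒ B → X ⇒ Y → Set e′
  Square p q f f̂ = F₁ f ⨾ q ≈ p ⨾ f̂

  id□ : ∀ {A X} {p : F₀ A ⇒ X} → Square p p M.id id
  id□ = trans (F-id ⟨⨾⟩ refl) (trans idˡ (sym idʳ))

  F□ : ∀ {A B} (f : A M.⇒ B) → Square id id f (F₁ f)
  F□ f = trans idʳ (sym idˡ)

  _⟫_ : ∀ {A B C X Y Z} {p : F₀ A ⇒ X} {q : F₀ B ⇒ Y} {r : F₀ C ⇒ Z}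
          {f : A M.⇒ B} {g : B M.⇒ C} {f̂ : X ⇒ Y} {ĝ : Y ⇒ Z} →
        Square p q f f̂ → Square q r g ĝ → Square p r (f M.⨾ g) (f̂ ⨾ ĝ)
  a ⟫ b = trans (F-⨾ ⟨⨾⟩ refl) (trans (pullʳ b) (trans (pullˡ a) assoc))

  -- The comonoidal axioms yield squares over `α⇒` and `ρ⇒`; this turns them into squares over `α⇐`
  -- and `ρ⇐`.
  inverse□ : ∀ {A B X Y} {p : F₀ A ⇒ X} {q : F₀ B ⇒ Y}
               {f : A M.⇒ B} {g : B M.⇒ A} {f̂ : X ⇒ Y} {ĝ : Y ⇒ X} →
             g M.⨾ f M.≈ M.id → f̂ ⨾ ĝ ≈ id → Square p q f f̂ → Square q p g ĝ
  inverse□ {p = p} {q} {f} {g} {f̂} {ĝ} gf fg a = begin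
    F₁ g ⨾ p                 ≈⟨ refl ⟨⨾⟩ cancelʳ fg ⟨
    F₁ g ⨾ ((p ⨾ f̂) ⨾ ĝ)     ≈⟨ refl ⟨⨾⟩ a ⟨⨾⟩ refl ⟨
    F₁ g ⨾ ((F₁ f ⨾ q) ⨾ ĝ)  ≈⟨ refl ⟨⨾⟩ assoc ⟩
    F₁ g ⨾ (F₁ f ⨾ (q ⨾ ĝ))  ≈⟨ cancelˡ (trans (sym F-⨾) (trans (F-resp-≈ gf) F-id)) ⟩
    q ⨾ ĝ                    ∎

  _⊗□_ : ∀ {A B X Y A′ B′ X′ Y′} {p : F₀ A ⇒ X} {q : F₀ B ⇒ Y} {p′ : F₀ A′ ⇒ X′}
           {q′ : F₀ B′ ⇒ Y′} {f : A M.⇒ B} {g : A′ M.⇒ B′} {f̂ : X ⇒ Y} {ĝ : X′ ⇒ Y′} →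
         Square p q f f̂ → Square p′ q′ g ĝ →
         Square (p ⊗ p′) (q ⊗ q′) (f M.⊕₁ g) (f̂ ⊕₁ ĝ)
  _⊗□_ {p = p} {q} {p′} {q′} {f} {g} {f̂} {ĝ} a b = begin
    F₁ (f M.⊕₁ g) ⨾ (m _ _ ⨾ (q ⊕₁ q′))       ≈⟨ pullˡ (m-natural f g) ⟩
    (m _ _ ⨾ (F₁ f ⊕₁ F₁ g)) ⨾ (q ⊕₁ q′)      ≈⟨ pullʳ (sym ⊕-⨾) ⟩
    m _ _ ⨾ ((F₁ f ⨾ q) ⊕₁ (F₁ g ⨾ q′))       ≈⟨ refl ⟨⨾⟩ ⊕-resp-≈ a b ⟩
    m _ _ ⨾ ((p ⨾ f̂) ⊕₁ (p′ ⨾ ĝ))             ≈⟨ refl ⟨⨾⟩ ⊕-⨾ ⟩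
    m _ _ ⨾ ((p ⊕₁ p′) ⨾ (f̂ ⊕₁ ĝ))            ≈⟨ assoc ⟨
    (m _ _ ⨾ (p ⊕₁ p′)) ⨾ (f̂ ⊕₁ ĝ)            ∎

  module _ {A B C X Y Z} {p : F₀ A ⇒ X} {q : F₀ B ⇒ Y} {r : F₀ C ⇒ Z} where
    -- With identity legs this is `m-assoc`. General legs are split off by functoriality of the
    -- tensor and carried past the associator by naturality.
    α□ : Square ((p ⊗ q) ⊗ r) (p ⊗ q ⊗ r) (M.α⇒ A B C) (α⇒ X Y Z)
    α□ = begin
      F₁ (M.α⇒ A B C) ⨾ (m _ _ ⨾ (p ⊕₁ (m _ _ ⨾ (q ⊕₁ r))))
        ≈⟨ refl ⟨⨾⟩ refl ⟨⨾⟩ ⊕-⨾ʳ ⟩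
      F₁ (M.α⇒ A B C) ⨾ (m _ _ ⨾ ((id ⊕₁ m _ _) ⨾ (p ⊕₁ (q ⊕₁ r))))
        ≈⟨ trans (refl ⟨⨾⟩ sym assoc) (pullˡ (sym assoc)) ⟩
      (F₁ (M.α⇒ A B C) ⨾ m _ _ ⨾ (id ⊕₁ m _ _)) ⨾ (p ⊕₁ (q ⊕₁ r))
        ≈⟨ m-assoc A B C ⟨⨾⟩ refl ⟨
      (m _ _ ⨾ (m _ _ ⊕₁ id) ⨾ α⇒ _ _ _) ⨾ (p ⊕₁ (q ⊕₁ r))
        ≈⟨ pullʳ (sym (α-natural p q r)) ⟩
      (m _ _ ⨾ (m _ _ ⊕₁ id)) ⨾ (((p ⊕₁ q) ⊕₁ r) ⨾ α⇒ X Y Z)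
        ≈⟨ trans (sym assoc) (pullʳ (sym ⊕-⨾ˡ) ⟨⨾⟩ refl) ⟩
      (m _ _ ⨾ ((m _ _ ⨾ (p ⊕₁ q)) ⊕₁ r)) ⨾ α⇒ X Y Z ∎

    α⁻¹□ : Square (p ⊗ q ⊗ r) ((p ⊗ q) ⊗ r) (M.α⇐ A B C) (α⇐ X Y Z)
    α⁻¹□ = inverse□ M.α-isoʳ α-isoˡ α□

  module _ {A B X Y} {p : F₀ A ⇒ X} {q : F₀ B ⇒ Y} where
    β□ : Square (p ⊗ q) (q ⊗ p) (M.β A B) (β X Y)
    β□ = begin
      F₁ (M.β A B) ⨾ (m B A ⨾ (q ⊕₁ p))  ≈⟨ pullˡ (sym (m-sym A B)) ⟩
      (m A B ⨾ β _ _) ⨾ (q ⊕₁ p)         ≈⟨ pullʳ (sym (β-natural p q)) ⟩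
      m A B ⨾ ((p ⊕₁ q) ⨾ β X Y)         ≈⟨ assoc ⟨
      (m A B ⨾ (p ⊕₁ q)) ⨾ β X Y         ∎

  module _ {A X} {p : F₀ A ⇒ X} where
    λ□ : Square (m⊥ ⊗ p) p (M.λ⇒ A) (λ⇒ X)
    λ□ = sym (begin
      (m _ _ ⨾ (m⊥ ⊕₁ p)) ⨾ λ⇒ X                  ≈⟨ (refl ⟨⨾⟩ split) ⟨⨾⟩ refl ⟩
      (m _ _ ⨾ ((m⊥ ⊕₁ id) ⨾ (id ⊕₁ p))) ⨾ λ⇒ X   ≈⟨ trans (sym assoc ⟨⨾⟩ refl) (pullʳ (λ-natural p)) ⟩
      (m _ _ ⨾ (m⊥ ⊕₁ id)) ⨾ (λ⇒ _ ⨾ p)           ≈⟨ m-unitˡ A ⟨⨾⟩ refl ⟩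
      (F₁ (M.λ⇒ A) ⨾ λ⇐ _) ⨾ (λ⇒ _ ⨾ p)           ≈⟨ pullʳ (cancelˡ λ-isoʳ) ⟩
      F₁ (M.λ⇒ A) ⨾ p                             ∎)
      where
        split : m⊥ ⊕₁ p ≈ (m⊥ ⊕₁ id) ⨾ (id ⊕₁ p)
        split = trans (⊕-resp-≈ (sym idʳ) refl) ⊕-⨾ˡ

    ρ□ : Square (p ⊗ m⊥) p (M.ρ⇒ A) (ρ⇒ X)
    ρ□ = sym (begin
      (m _ _ ⨾ (p ⊕₁ m⊥)) ⨾ ρ⇒ X                  ≈⟨ (refl ⟨⨾⟩ split) ⟨⨾⟩ refl ⟩
      (m _ _ ⨾ ((id ⊕₁ m⊥) ⨾ (p ⊕₁ id))) ⨾ ρ⇒ X   ≈⟨ trans (sym assoc ⟨⨾⟩ refl) (pullʳ (ρ-natural p)) ⟩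
      (m _ _ ⨾ (id ⊕₁ m⊥)) ⨾ (ρ⇒ _ ⨾ p)           ≈⟨ m-unitʳ A ⟨⨾⟩ refl ⟩
      (F₁ (M.ρ⇒ A) ⨾ ρ⇐ _) ⨾ (ρ⇒ _ ⨾ p)           ≈⟨ pullʳ (cancelˡ ρ-isoʳ) ⟩
      F₁ (M.ρ⇒ A) ⨾ p                             ∎)
      where
        split : p ⊕₁ m⊥ ≈ (id ⊕₁ m⊥) ⨾ (p ⊕₁ id)
        split = trans (⊕-resp-≈ refl (sym idʳ)) ⊕-⨾ʳ

    ρ⁻¹□ : Square p (p ⊗ m⊥) (M.ρ⇐ A) (ρ⇐ X)
    ρ⁻¹□ = inverse□ M.ρ-isoʳ ρ-isoˡ ρ□

  -- Both categories build `interchange` from the same word in structural maps, so the squares for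
  -- its factors paste together.
  interchange□ : ∀ {A B C D X Y Z W}
                   {p : F₀ A ⇒ X} {q : F₀ B ⇒ Y} {r : F₀ C ⇒ Z} {s : F₀ D ⇒ W} →
                 Square ((p ⊗ q) ⊗ r ⊗ s) ((p ⊗ r) ⊗ q ⊗ s)
                        (M.interchange A B C D) (interchange X Y Z W)
  interchange□ = α□ ⟫ id□ ⊗□ (α⁻¹□ ⟫ β□ ⊗□ id□ ⟫ α□) ⟫ α⁻¹□

  -- A transfer principle: over a split epimorphic leg, `f̂` is determined by `f`, so an equation in
  -- the source category yields one between the maps lying over its two sides.
  square-unique : ∀ {A B X Y} {p : F₀ A ⇒ X} {q : F₀ B ⇒ Y} {f g : A M.⇒ B} {f̂ ĝ : X ⇒ Y} →
                  HasSection p → f M.≈ g → Square p q f f̂ → Square p q g ĝ → f̂ ≈ ĝ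
  square-unique s fg a b = section-cancel s (trans (sym a) (trans (F-resp-≈ fg ⟨⨾⟩ refl) b))

  record IsStrong : Set (o ⊔ ℓ′ ⊔ e′) where
    field
      k⊥    : ⊥ ⇒ F₀ M.⊥
      k     : ∀ A B → F₀ A ⊕₀ F₀ B ⇒ F₀ (A M.⊕₀ B)
      k⊥-m⊥ : k⊥ ⨾ m⊥ ≈ id
      m⊥-k⊥ : m⊥ ⨾ k⊥ ≈ id
      k-m   : ∀ {A B} → k A B ⨾ m A B ≈ id
      m-k   : ∀ {A B} → m A B ⨾ k A B ≈ id

    m⊥-section : HasSection m⊥
    m⊥-section = k⊥ , k⊥-m⊥

    m-section : ∀ {A B} → HasSection (m A B)
    m-section = k _ _ , k-m

    ⊗-section : ∀ {A B X Y} {p : F₀ A ⇒ X} {q : F₀ B ⇒ Y} →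
                HasSection p → HasSection q → HasSection (p ⊗ q)
    ⊗-section s t = ⨾-section m-section (⊕-section s t)

-- Commutative monoids carried along a strong functor.

module ImageMonoids {o ℓ e o′ ℓ′ e′}
  (𝓒 : CocartesianCategory o ℓ e) (M : SymmetricMonoidalCategory o′ ℓ′ e′)
  {J : Functor (CocartesianCategory.U 𝓒) (SymmetricMonoidalCategory.U M)}
  {maps : ComonoidalMaps (cocartesianSMC 𝓒) M J}
  (isSC : IsSymmetricComonoidal (cocartesianSMC 𝓒) M maps)
  (isStrong : Squares.IsStrong (cocartesianSMC 𝓒) M isSC) where
  private
    module C = CocartesianCategory 𝓒
    module C⊕ = SymmetricMonoidalCategory (cocartesianSMC 𝓒)
  open Coproducts 𝓒
  open SymmetricMonoidalCategory M
  open Equiv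
  open Functor J
  open ComonoidalMaps maps
  open Sections U
  open Tensor M
  open Squares (cocartesianSMC 𝓒) M isSC
  open IsStrong isStrong

  w : ∀ R → ⊥ ⇒ F₀ R
  w R = k⊥ ⨾ F₁ C.¡

  c : ∀ R → F₀ R ⊕₀ F₀ R ⇒ F₀ R
  c R = k R R ⨾ F₁ ∇

  m⊥-w : ∀ {R} → m⊥ ⨾ w R ≈ F₁ C.¡
  m⊥-w = cancelˡ m⊥-k⊥

  m-c : ∀ {R} → m R R ⨾ c R ≈ F₁ ∇
  m-c = cancelˡ m-k

  -- With `c□`, this brings the monoid structure into the square calculus, so that laws of `¡` and
  -- `∇` transfer without handling `k⊥` and `k`.
  w□ : ∀ {R} → Square m⊥ id C.¡ (w R)
  w□ = trans idʳ (sym m⊥-w)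

  c□ : ∀ {R} → Square (id ⊗ id) id ∇ (c R)
  c□ = trans idʳ (trans (sym m-c) (sym id⊗id ⟨⨾⟩ refl))

  -- For each law, the two pasted squares follow the two sides and lie over the corresponding law of
  -- `¡` and `∇`.
  isCommutativeMonoid : ∀ R → IsCommutativeMonoid M (F₀ R) (w R) (c R)
  isCommutativeMonoid R = record
    { c-assoc = square-unique (⊗-section id⊗id-section id-section) ∇-assoc
        (c□ ⊗□ id□ ⟫ c□) (α□ ⟫ id□ ⊗□ c□ ⟫ c□)
    ; c-unitˡ = square-unique (⊗-section m⊥-section id-section) ∇-unitˡ (w□ ⊗□ id□ ⟫ c□) λ□
    ; c-unitʳ = square-unique (⊗-section id-section m⊥-section) ∇-unitʳ (id□ ⊗□ w□ ⟫ c□) ρ□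
    -- At identity components, `β-[]` is the symmetry of the codiagonal.
    ; c-comm  = square-unique id⊗id-section β-[] (β□ ⟫ c□) c□ }
    where
      id⊗id-section : ∀ {R S} → HasSection (id {F₀ R} ⊗ id {F₀ S})
      id⊗id-section = ⊗-section id-section id-section

  w-natural : ∀ {R S} (g : R C.⇒ S) → w R ⨾ F₁ g ≈ w S
  w-natural g = square-unique m⊥-section ¡-unique₂ (w□ ⟫ F□ g) w□

  c-natural : ∀ {R S} (g : R C.⇒ S) → c R ⨾ F₁ g ≈ (F₁ g ⊕₁ F₁ g) ⨾ c S
  c-natural g = square-unique (⊗-section id-section id-section) ∇-⨾
    (c□ ⟫ F□ g) (F□ g ⊗□ F□ g ⟫ c□)

  -- Both sides lie over maps `𝟘 ⇒ R + S`, which agree by initiality.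
  w-m : ∀ R S → ρ⇐ ⊥ ⨾ (w R ⊕₁ w S) ≈ w (R C.+ S) ⨾ m R S
  w-m R S = square-unique m⊥-section ¡-unique₂
    (ρ⁻¹□ ⟫ w□ ⊗□ w□)
    (trans (refl ⟨⨾⟩ id⊗id) (trans (sym m⊥-w ⟨⨾⟩ refl) assoc))

  w-m⊥ : w C.𝟘 ⨾ m⊥ ≈ id
  w-m⊥ = trans ((refl ⟨⨾⟩ trans (F-resp-≈ ¡-unique₂) F-id) ⟨⨾⟩ refl)
    (trans (idʳ ⟨⨾⟩ refl) k⊥-m⊥)

  -- Precomposed with the split epimorphism `m`, both sides become `F₁ ∇ ⨾ m R S`: the left through
  -- `interchange□` and `∇-⊕`, the right by cancelling `k`.
  c-m : ∀ R S → ((m R S ⊕₁ m R S) ⨾ interchange (F₀ R) (F₀ S) (F₀ R) (F₀ S)) ⨾ (c R ⊕₁ c S)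
                  ≈ c (R C.+ S) ⨾ m R S
  c-m R S = section-cancel m-section (begin
    m _ _ ⨾ (((m R S ⊕₁ m R S) ⨾ interchange _ _ _ _) ⨾ (c R ⊕₁ c S))
      ≈⟨ refl ⟨⨾⟩ ((⊕-resp-≈ id⊗id id⊗id ⟨⨾⟩ refl) ⟨⨾⟩ refl) ⟨
    m _ _ ⨾ ((((id ⊗ id) ⊕₁ (id ⊗ id)) ⨾ interchange _ _ _ _) ⨾ (c R ⊕₁ c S))
      ≈⟨ trans (refl ⟨⨾⟩ assoc) (sym assoc) ⟩
    ((id ⊗ id) ⊗ id ⊗ id) ⨾ (interchange _ _ _ _ ⨾ (c R ⊕₁ c S))
      ≈⟨ interchange□ ⟫ c□ ⊗□ c□ ⟨
    F₁ (C⊕.interchange R S R S C.⨾ (∇ C⊕.⊕₁ ∇)) ⨾ (id ⊗ id)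
      ≈⟨ F-resp-≈ ∇-⊕ ⟨⨾⟩ id⊗id ⟩
    F₁ ∇ ⨾ m R S
      ≈⟨ m-c ⟨⨾⟩ refl ⟨
    (m _ _ ⨾ c (R C.+ S)) ⨾ m R S
      ≈⟨ assoc ⟩
    m _ _ ⨾ (c (R C.+ S) ⨾ m R S) ∎)
    where open HomReasoning

  -- On `𝟘` the codiagonal is the left unitor, whose coherence is `λ□`.
  c-m⊥ : c C.𝟘 ⨾ m⊥ ≈ (m⊥ ⊕₁ m⊥) ⨾ λ⇒ ⊥
  c-m⊥ = section-cancel m-section (begin
    m _ _ ⨾ (c C.𝟘 ⨾ m⊥)          ≈⟨ pullˡ m-c ⟩
    F₁ ∇ ⨾ m⊥                     ≈⟨ F-resp-≈ ∇-𝟘 ⟨⨾⟩ refl ⟩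
    F₁ (C⊕.λ⇒ C.𝟘) ⨾ m⊥           ≈⟨ λ□ ⟩
    (m⊥ ⊗ m⊥) ⨾ λ⇒ ⊥              ≈⟨ assoc ⟩
    m _ _ ⨾ ((m⊥ ⊕₁ m⊥) ⨾ λ⇒ ⊥)   ∎)
    where open HomReasoning

-- Composites of symmetric comonoidal functors.

module _ {o ℓ e o′ ℓ′ e′ o″ ℓ″ e″}
  (M : SymmetricMonoidalCategory o ℓ e)
  (N : SymmetricMonoidalCategory o′ ℓ′ e′)
  (P : SymmetricMonoidalCategory o″ ℓ″ e″)
  {F : Functor (SymmetricMonoidalCategory.U M) (SymmetricMonoidalCategory.U N)}
  {G : Functor (SymmetricMonoidalCategory.U N) (SymmetricMonoidalCategory.U P)}
  {mF : ComonoidalMaps M N F} {mG : ComonoidalMaps N P G}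
  (isF : IsSymmetricComonoidal M N mF) (isG : IsSymmetricComonoidal N P mG) where
  private
    module M = SymmetricMonoidalCategory M
    module N = SymmetricMonoidalCategory N
    module F where
      open Functor F public
      open ComonoidalMaps mF public
      open IsSymmetricComonoidal isF public
      open Squares M N isF public
    module G where
      open Functor G public
      open ComonoidalMaps mG public
      open IsSymmetricComonoidal isG public
      open Squares N P isG public
    open SymmetricMonoidalCategory P
    open Equiv
    open Sections U
    open HomReasoning

    infixl 7 _▹_
    _▹_ : ∀ {A X Y} → F.F₀ A N.⇒ X → G.F₀ X ⇒ Y → G.F₀ (F.F₀ A) ⇒ Y
    p ▹ p′ = G.F₁ p ⨾ p′

    paste : ∀ {A B X Y X′ Y′} {p : F.F₀ A N.⇒ X} {q : F.F₀ B N.⇒ Y}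
              {p′ : G.F₀ X ⇒ X′} {q′ : G.F₀ Y ⇒ Y′}
              {f : A M.⇒ B} {g : X N.⇒ Y} {h : X′ ⇒ Y′} →
            F.Square p q f g → G.Square p′ q′ g h →
            G.F₁ (F.F₁ f) ⨾ (q ▹ q′) ≈ (p ▹ p′) ⨾ h
    paste {p = p} {q} {p′} {q′} {f} {g} {h} a b = begin
      G.F₁ (F.F₁ f) ⨾ (G.F₁ q ⨾ q′)  ≈⟨ pullˡ (sym G.F-⨾) ⟩
      G.F₁ (F.F₁ f N.⨾ q) ⨾ q′       ≈⟨ trans (G.F-resp-≈ a) G.F-⨾ ⟨⨾⟩ refl ⟩
      (G.F₁ p ⨾ G.F₁ g) ⨾ q′         ≈⟨ pullʳ b ⟩
      G.F₁ p ⨾ (p′ ⨾ h)              ≈⟨ assoc ⟨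
      (G.F₁ p ⨾ p′) ⨾ h              ∎

    -- Naturality of `G.m` separates an iterated comonoidal map of the composite into an `F` layer
    -- and a `G` layer, the form `paste` requires.
    ▹-⊗ : ∀ {A B X Y X′ Y′} {p : F.F₀ A N.⇒ X} {q : F.F₀ B N.⇒ Y}
            {p′ : G.F₀ X ⇒ X′} {q′ : G.F₀ Y ⇒ Y′} →
          (F.m A B ▹ G.m _ _) ⨾ ((p ▹ p′) ⊕₁ (q ▹ q′)) ≈ (p F.⊗ q) ▹ (p′ G.⊗ q′)
    ▹-⊗ {A} {B} {p = p} {q} {p′} {q′} = begin
      (G.F₁ (F.m A B) ⨾ G.m _ _) ⨾ ((G.F₁ p ⨾ p′) ⊕₁ (G.F₁ q ⨾ q′))
        ≈⟨ refl ⟨⨾⟩ ⊕-⨾ ⟩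
      (G.F₁ (F.m A B) ⨾ G.m _ _) ⨾ ((G.F₁ p ⊕₁ G.F₁ q) ⨾ (p′ ⊕₁ q′))
        ≈⟨ pullʳ (pullˡ (sym (G.m-natural p q))) ⟩
      G.F₁ (F.m A B) ⨾ ((G.F₁ (p N.⊕₁ q) ⨾ G.m _ _) ⨾ (p′ ⊕₁ q′))
        ≈⟨ trans (refl ⟨⨾⟩ assoc) (pullˡ (sym G.F-⨾)) ⟩
      (p F.⊗ q) ▹ (p′ G.⊗ q′) ∎

    id▹id : ∀ {A} → id ≈ N.id {F.F₀ A} ▹ id
    id▹id = sym (trans idʳ G.F-id)

    m-▹ : ∀ {A B} → F.m A B ▹ G.m _ _ ≈ (N.id F.⊗ N.id) ▹ (id G.⊗ id)
    m-▹ = sym (G.F-resp-≈ F.id⊗id ⟨⨾⟩ G.id⊗id)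

  ⨾-isSymmetricComonoidal : IsSymmetricComonoidal M P (compMaps M N P mF mG)
  ⨾-isSymmetricComonoidal = record
    { m-natural = λ f g → paste (F.m-natural f g) (G.m-natural (F.F₁ f) (F.F₁ g))
    ; m-assoc = λ A B C → begin
        m′ (A M.⊕₀ B) C ⨾ (m′ A B ⊕₁ id) ⨾ α⇒ _ _ _
          ≈⟨ trans (refl ⟨⨾⟩ ⊕-resp-≈ m-▹ id▹id) ▹-⊗ ⟨⨾⟩ refl ⟩
        (((N.id F.⊗ N.id) F.⊗ N.id) ▹ ((id G.⊗ id) G.⊗ id)) ⨾ α⇒ _ _ _
          ≈⟨ paste F.α□ G.α□ ⟨
        G.F₁ (F.F₁ (M.α⇒ A B C)) ⨾ ((N.id F.⊗ N.id F.⊗ N.id) ▹ (id G.⊗ id G.⊗ id))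
          ≈⟨ refl ⟨⨾⟩ trans (refl ⟨⨾⟩ ⊕-resp-≈ id▹id m-▹) ▹-⊗ ⟨
        G.F₁ (F.F₁ (M.α⇒ A B C)) ⨾ (m′ A (B M.⊕₀ C) ⨾ (id ⊕₁ m′ B C))
          ≈⟨ assoc ⟨
        G.F₁ (F.F₁ (M.α⇒ A B C)) ⨾ m′ A (B M.⊕₀ C) ⨾ (id ⊕₁ m′ B C) ∎
    ; m-unitˡ = λ A → begin
        m′ M.⊥ A ⨾ (m⊥′ ⊕₁ id)
          ≈⟨ trans (refl ⟨⨾⟩ ⊕-resp-≈ refl id▹id) ▹-⊗ ⟩
        (F.m⊥ F.⊗ N.id) ▹ (G.m⊥ G.⊗ id)
          -- The axiom is phrased with `λ⇐` but the squares lie over `λ⇒`, so the inverse pair is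
          -- inserted first.
          ≈⟨ cancelʳ λ-isoˡ ⟨
        (((F.m⊥ F.⊗ N.id) ▹ (G.m⊥ G.⊗ id)) ⨾ λ⇒ _) ⨾ λ⇐ _
          ≈⟨ paste F.λ□ G.λ□ ⟨⨾⟩ refl ⟨
        (G.F₁ (F.F₁ (M.λ⇒ A)) ⨾ (N.id ▹ id)) ⨾ λ⇐ _
          ≈⟨ trans (refl ⟨⨾⟩ sym id▹id) idʳ ⟨⨾⟩ refl ⟩
        G.F₁ (F.F₁ (M.λ⇒ A)) ⨾ λ⇐ _ ∎
    ; m-unitʳ = λ A → begin
        m′ A M.⊥ ⨾ (id ⊕₁ m⊥′)
          ≈⟨ trans (refl ⟨⨾⟩ ⊕-resp-≈ id▹id refl) ▹-⊗ ⟩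
        (N.id F.⊗ F.m⊥) ▹ (id G.⊗ G.m⊥)
          ≈⟨ cancelʳ ρ-isoˡ ⟨
        (((N.id F.⊗ F.m⊥) ▹ (id G.⊗ G.m⊥)) ⨾ ρ⇒ _) ⨾ ρ⇐ _
          ≈⟨ paste F.ρ□ G.ρ□ ⟨⨾⟩ refl ⟨
        (G.F₁ (F.F₁ (M.ρ⇒ A)) ⨾ (N.id ▹ id)) ⨾ ρ⇐ _
          ≈⟨ trans (refl ⟨⨾⟩ sym id▹id) idʳ ⟨⨾⟩ refl ⟩
        G.F₁ (F.F₁ (M.ρ⇒ A)) ⨾ ρ⇐ _ ∎
    ; m-sym = λ A B → sym (paste (N.Equiv.sym (F.m-sym A B)) (sym (G.m-sym _ _))) }
    where open ComonoidalMaps (compMaps M N P mF mG) renaming (m to m′; m⊥ to m⊥′)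

-- Strength of the right adjoint of a comonoidal adjunction.

module ComonoidalAdjunction {o ℓ e o′ ℓ′ e′}
  {M : SymmetricMonoidalCategory o ℓ e} {N : SymmetricMonoidalCategory o′ ℓ′ e′}
  (H⊣J : SymmetricComonoidalAdjunction M N) where
  open SymmetricComonoidalAdjunction H⊣J
  private
    module N where
      open SymmetricMonoidalCategory N public
      open Sections (SymmetricMonoidalCategory.U N) public
    module H where
      open Functor left.functor public
      open ComonoidalMaps left.maps public
    module J where
      open Functor right.functor public
      open ComonoidalMaps right.maps public
      open IsSymmetricComonoidal right.isSymmetricComonoidal public
    module η where
      open NaturalTransformation unit public
      open IsComonoidalTransformation unit-comonoidal public
    module ε where
      open NaturalTransformation counit public
      open IsComonoidalTransformation counit-comonoidal public
  open SymmetricMonoidalCategory M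
  open Equiv
  open Sections U
  open HomReasoning

  transpose : ∀ {A R} → H.F₀ A N.⇒ R → A ⇒ J.F₀ R
  transpose g = η.η _ ⨾ J.F₁ g

  transpose-ε : ∀ {A R} {g : H.F₀ A N.⇒ R} → H.F₁ (transpose g) N.⨾ ε.η R N.≈ g
  transpose-ε = N.Equiv.trans (H.F-⨾ N.⟨⨾⟩ N.Equiv.refl)
    (N.Equiv.trans (N.pullʳ (ε.natural _)) (N.cancelˡ zig))

  transpose-∘ : ∀ {A B R} {f : A ⇒ B} {g : H.F₀ B N.⇒ R} →
                f ⨾ transpose g ≈ transpose (H.F₁ f N.⨾ g)
  transpose-∘ {f = f} {g} = begin
    f ⨾ (η.η _ ⨾ J.F₁ g)             ≈⟨ pullˡ (η.natural f) ⟩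
    (η.η _ ⨾ J.F₁ (H.F₁ f)) ⨾ J.F₁ g ≈⟨ pullʳ (sym J.F-⨾) ⟩
    η.η _ ⨾ J.F₁ (H.F₁ f N.⨾ g)      ∎

  -- This is comonoidality of the counit, read as a statement about transposes: precomposing the
  -- candidate inverse with `J.m` gives the transpose of the counit, which is the identity.
  j-ε⊕ε : ∀ {R S} → H.F₁ (J.m R S) N.⨾ (H.m _ _ N.⨾ (ε.η R N.⊕₁ ε.η S)) N.≈ ε.η (R N.⊕₀ S)
  j-ε⊕ε = N.Equiv.trans (N.Equiv.sym N.assoc) (N.Equiv.trans (ε.preserves-m _ _) N.idʳ)

  j⊥-h⊥ : H.F₁ J.m⊥ N.⨾ H.m⊥ N.≈ ε.η N.⊥
  j⊥-h⊥ = N.Equiv.trans (N.Equiv.sym ε.preserves-m⊥) N.idʳ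

  -- Comonoidality of the unit handles the composites that begin with the inverse, comonoidality of
  -- the counit those that end with it.
  rightAdjoint-isStrong : Squares.IsStrong N M right.isSymmetricComonoidal
  rightAdjoint-isStrong = record
    { k⊥    = transpose H.m⊥
    ; k     = λ R S → transpose (H.m _ _ N.⨾ (ε.η R N.⊕₁ ε.η S))
    ; k⊥-m⊥ = trans assoc η.preserves-m⊥
    ; m⊥-k⊥ = trans transpose-∘ (trans (refl ⟨⨾⟩ J.F-resp-≈ j⊥-h⊥) zag)
    ; k-m   = λ {R} {S} → begin
        (η.η _ ⨾ J.F₁ (H.m _ _ N.⨾ (ε.η R N.⊕₁ ε.η S))) ⨾ J.m R S
          ≈⟨ trans ((refl ⟨⨾⟩ J.F-⨾) ⟨⨾⟩ refl) assoc ⟩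
        η.η _ ⨾ ((J.F₁ (H.m _ _) ⨾ J.F₁ (ε.η R N.⊕₁ ε.η S)) ⨾ J.m R S)
          ≈⟨ refl ⟨⨾⟩ trans (pullʳ (J.m-natural _ _)) (sym assoc) ⟩
        η.η _ ⨾ ((J.F₁ (H.m _ _) ⨾ J.m _ _) ⨾ (J.F₁ (ε.η R) ⊕₁ J.F₁ (ε.η S)))
          -- The bracketed factor is the comonoidal map of the composite functor, so `η.preserves-m`
          -- applies.
          ≈⟨ pullˡ (trans (sym (η.preserves-m _ _)) idˡ) ⟩
        (η.η _ ⊕₁ η.η _) ⨾ (J.F₁ (ε.η R) ⊕₁ J.F₁ (ε.η S))
          ≈⟨ trans (sym ⊕-⨾) (trans (⊕-resp-≈ zag zag) ⊕-id) ⟩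
        id ∎
    ; m-k   = trans transpose-∘ (trans (refl ⟨⨾⟩ J.F-resp-≈ j-ε⊕ε) zag) }

-- The dual linear structure of a dual LNL model.

module Model {o ℓ e o′ ℓ′ e′} (𝓜 : DualLNLModel o ℓ e o′ ℓ′ e′) where
  open DualLNLModel 𝓜
  open SymmetricComonoidalAdjunction H⊣J
  private
    module C where
      open CocartesianCategory 𝓒.cocartesian public hiding (U)
      open SymmetricMonoidalCategory 𝓒.smc public using (U; _⊕₁_)
      open Sections U public
    module H where
      open Functor left.functor public
      open ComonoidalMaps left.maps public
    module J where
      open Functor right.functor public
      open ComonoidalMaps right.maps public
      open IsSymmetricComonoidal right.isSymmetricComonoidal public
    module ε = NaturalTransformation counit
  open SymmetricMonoidalCoclosedCategory 𝓛
  open Equiv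
  open Sections U
  open Tensor smc
  open HomReasoning
  open Coproducts 𝓒.cocartesian using (∇)
  open ComonoidalAdjunction H⊣J
  open ImageMonoids 𝓒.cocartesian smc right.isSymmetricComonoidal rightAdjoint-isStrong
  open ComonoidalMonadData (inducedMonad 𝓜) hiding (unit)

  -- Both `w` and `c` are a transposed map followed by an image under `J`; this computes the effect
  -- of the algebra structure on such maps.
  pullε : ∀ {A R S} {f : A ⇒ J.F₀ R} {g : R C.⇒ S} → T₁ (f ⨾ J.F₁ g) ⨾ J.F₁ (ε.η S) ≈
          J.F₁ (H.F₁ f C.⨾ ε.η R) ⨾ J.F₁ g
  pullε {f = f} {g} = begin
    J.F₁ (H.F₁ (f ⨾ J.F₁ g)) ⨾ J.F₁ (ε.η _)   ≈⟨ J.F-⨾ ⟨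
    J.F₁ (H.F₁ (f ⨾ J.F₁ g) C.⨾ ε.η _)        ≈⟨ J.F-resp-≈ (C.Equiv.trans (H.F-⨾ C.⟨⨾⟩ C.Equiv.refl)
                                                   (C.Equiv.trans (C.pullʳ (ε.natural g)) (C.Equiv.sym C.assoc))) ⟩
    J.F₁ ((H.F₁ f C.⨾ ε.η _) C.⨾ g)           ≈⟨ J.F-⨾ ⟩
    J.F₁ (H.F₁ f C.⨾ ε.η _) ⨾ J.F₁ g          ∎

  -- Naturality of `J.m` rewrites the algebra structure on a tensor so that it ends in `J.m`, ready
  -- to cancel against `k` in `c`.
  r-Jε : ∀ {R S} → r (J.F₀ R) (J.F₀ S) ⨾ (J.F₁ (ε.η R) ⊕₁ J.F₁ (ε.η S)) ≈
         J.F₁ (H.m _ _ C.⨾ (ε.η R C.⊕₁ ε.η S)) ⨾ J.m R S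
  r-Jε = trans (pullʳ (sym (J.m-natural _ _))) (pullˡ (sym J.F-⨾))

  isSymmetricComonoidalMonad : IsSymmetricComonoidalMonad smc (inducedMonad 𝓜)
  isSymmetricComonoidalMonad = record
    { isSymmetricComonoidal = ⨾-isSymmetricComonoidal smc 𝓒.smc smc
        left.isSymmetricComonoidal right.isSymmetricComonoidal
    ; unit-comonoidal = unit-comonoidal
    ; mult-comonoidal = record
        { preserves-m = λ A B → begin
            (T₁ (r A B) ⨾ r (T₀ A) (T₀ B)) ⨾ (μ A ⊕₁ μ B)
              ≈⟨ pullʳ r-Jε ⟩
            T₁ (r A B) ⨾ (J.F₁ (H.m _ _ C.⨾ (ε.η _ C.⊕₁ ε.η _)) ⨾ J.m _ _)
              ≈⟨ pullˡ (sym J.F-⨾) ⟩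
            J.F₁ (H.F₁ (r A B) C.⨾ (H.m _ _ C.⨾ (ε.η _ C.⊕₁ ε.η _))) ⨾ J.m _ _
              ≈⟨ J.F-resp-≈ (counit-square j-ε⊕ε) ⟨⨾⟩ refl ⟩
            J.F₁ (ε.η _ C.⨾ H.m A B) ⨾ J.m _ _
              ≈⟨ trans (J.F-⨾ ⟨⨾⟩ refl) assoc ⟩
            μ (A ⊕₀ B) ⨾ r A B ∎
        ; preserves-m⊥ = begin
            μ ⊥ ⨾ r⊥
              ≈⟨ pullˡ (sym J.F-⨾) ⟩
            J.F₁ (ε.η _ C.⨾ H.m⊥) ⨾ J.m⊥
              ≈⟨ J.F-resp-≈ (counit-square j⊥-h⊥) ⟨⨾⟩ refl ⟨
            J.F₁ (H.F₁ r⊥ C.⨾ H.m⊥) ⨾ J.m⊥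
              ≈⟨ trans (J.F-⨾ ⟨⨾⟩ refl) assoc ⟩
            T₁ r⊥ ⨾ r⊥ ∎ }
    ; μ-identityˡ = λ A → zag
    ; μ-identityʳ = λ A → trans (sym J.F-⨾) (trans (J.F-resp-≈ zig) J.F-id)
    ; μ-assoc     = λ A → trans (sym J.F-⨾) (trans (J.F-resp-≈ (C.Equiv.sym (ε.natural _))) J.F-⨾) }
    where
      -- Covers both clauses of comonoidality of `μ`: the hypothesis is comonoidality of the counit,
      -- and naturality of the counit moves `h` to the end.
      counit-square : ∀ {A R S} {h : H.F₀ A C.⇒ R} {f : J.F₀ R ⇒ S} {g : H.F₀ S C.⇒ R} →
                      H.F₁ f C.⨾ g C.≈ ε.η R →
                      H.F₁ (J.F₁ h ⨾ f) C.⨾ g C.≈ ε.η _ C.⨾ h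
      counit-square p = C.Equiv.trans (H.F-⨾ C.⟨⨾⟩ C.Equiv.refl)
        (C.Equiv.trans (C.pullʳ p) (ε.natural _))

  -- Both sides reduce to `J.F₁ H.m⊥ ⨾ J.F₁ ¡`: on the left `k⊥` is the transpose of `H.m⊥`, on the
  -- right `J.m⊥` cancels `k⊥`. The argument for `c` is parallel.
  w-algebra : ∀ {R} → T₁ (w R) ⨾ J.F₁ (ε.η R) ≈ r⊥ ⨾ w R
  w-algebra = trans pullε
    (trans (J.F-resp-≈ transpose-ε ⟨⨾⟩ refl) (sym (pullʳ m⊥-w)))

  c-algebra : ∀ {R} → T₁ (c R) ⨾ J.F₁ (ε.η R) ≈
              (r (J.F₀ R) (J.F₀ R) ⨾ (J.F₁ (ε.η R) ⊕₁ J.F₁ (ε.η R))) ⨾ c R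
  c-algebra = trans pullε
    (trans (J.F-resp-≈ transpose-ε ⟨⨾⟩ refl) (sym (trans (r-Jε ⟨⨾⟩ refl) (pullʳ m-c))))

  μ-section : ∀ {A} → HasSection (μ A)
  -- The section is the unit at `T₀ A`.
  μ-section = _ , zag

  module _ {A B} (f : T₀ A ⇒ T₀ B) (f-alg : IsAlgebraMorphism smc (inducedMonad 𝓜) (μ A) (μ B) f) where
    private
      f♯ : H.F₀ (T₀ A) C.⇒ H.F₀ B
      f♯ = H.F₁ f C.⨾ ε.η _

      μ-f : μ A ⨾ f ≈ J.F₁ f♯
      μ-f = trans (sym f-alg) (sym J.F-⨾)

    -- As an image under `J`, `μ A` preserves `w`; inserting it before `f` leaves a composite to
    -- which `w-natural` applies.
    algebraMorphism-w : w (H.F₀ A) ⨾ f ≈ w (H.F₀ B)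
    algebraMorphism-w = begin
      w _ ⨾ f             ≈⟨ w-natural (ε.η _) ⟨⨾⟩ refl ⟨
      (w _ ⨾ μ A) ⨾ f     ≈⟨ pullʳ μ-f ⟩
      w _ ⨾ J.F₁ f♯       ≈⟨ w-natural f♯ ⟩
      w _                 ∎

    -- Here `μ` has to be inserted in both arguments of `c`, so the equation is tested after the
    -- split epimorphism `μ A ⊕₁ μ A`.
    algebraMorphism-c : c (H.F₀ A) ⨾ f ≈ (f ⊕₁ f) ⨾ c (H.F₀ B)
    algebraMorphism-c = section-cancel (⊕-section μ-section μ-section) (begin
      (μ A ⊕₁ μ A) ⨾ (c _ ⨾ f)         ≈⟨ pullˡ (sym (c-natural (ε.η _))) ⟩
      (c _ ⨾ μ A) ⨾ f                  ≈⟨ pullʳ μ-f ⟩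
      c _ ⨾ J.F₁ f♯                    ≈⟨ c-natural f♯ ⟩
      (J.F₁ f♯ ⊕₁ J.F₁ f♯) ⨾ c _       ≈⟨ trans (⊕-resp-≈ (sym μ-f) (sym μ-f)) ⊕-⨾ ⟨⨾⟩ refl ⟩
      ((μ A ⊕₁ μ A) ⨾ (f ⊕₁ f)) ⨾ c _  ≈⟨ assoc ⟩
      (μ A ⊕₁ μ A) ⨾ ((f ⊕₁ f) ⨾ c _)  ∎)

  dualLinearStructure : DualLinearStructure 𝓛 (inducedMonad 𝓜)
  dualLinearStructure = record
    { isSymmetricComonoidalMonad = isSymmetricComonoidalMonad
    ; weakening   = record
        { η       = λ A → w (H.F₀ A)
        ; natural = λ f → trans idˡ (sym (w-natural (H.F₁ f))) }
    ; contraction = record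
        { η       = λ A → c (H.F₀ A)
        ; natural = λ f → sym (c-natural (H.F₁ f)) }
    ; w-comonoidal = record
        -- `r A B` is `J.F₁ (H.m A B)` followed by `J.m`: naturality of `w` handles the first factor
        -- and `w-m` the second. Contraction splits the same way.
        { preserves-m  = λ A B → trans (w-m _ _) (trans (sym (w-natural (H.m A B)) ⟨⨾⟩ refl) assoc)
        ; preserves-m⊥ = trans (pullˡ (w-natural H.m⊥)) w-m⊥ }
    ; c-comonoidal = record
        { preserves-m  = λ A B → begin
            ((r A B ⊕₁ r A B) ⨾ interchange _ _ _ _) ⨾ (c _ ⊕₁ c _)
              ≈⟨ trans (⊕-⨾ ⟨⨾⟩ refl) assoc ⟨⨾⟩ refl ⟩
            ((J.F₁ (H.m A B) ⊕₁ J.F₁ (H.m A B)) ⨾ ((J.m _ _ ⊕₁ J.m _ _) ⨾ interchange _ _ _ _)) ⨾ (c _ ⊕₁ c _)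
              ≈⟨ pullʳ (c-m _ _) ⟩
            (J.F₁ (H.m A B) ⊕₁ J.F₁ (H.m A B)) ⨾ (c _ ⨾ J.m _ _)
              ≈⟨ pullˡ (sym (c-natural (H.m A B))) ⟩
            (c _ ⨾ J.F₁ (H.m A B)) ⨾ J.m _ _
              ≈⟨ assoc ⟩
            c _ ⨾ r A B ∎
        ; preserves-m⊥ = begin
            c _ ⨾ r⊥
              ≈⟨ pullˡ (c-natural H.m⊥) ⟩
            ((J.F₁ H.m⊥ ⊕₁ J.F₁ H.m⊥) ⨾ c _) ⨾ J.m⊥
              ≈⟨ pullʳ c-m⊥ ⟩
            (J.F₁ H.m⊥ ⊕₁ J.F₁ H.m⊥) ⨾ ((J.m⊥ ⊕₁ J.m⊥) ⨾ λ⇒ ⊥)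
              ≈⟨ pullˡ (sym ⊕-⨾) ⟩
            (r⊥ ⊕₁ r⊥) ⨾ λ⇒ ⊥ ∎ }
    ; isCommutativeMonoid = λ A → isCommutativeMonoid (H.F₀ A)
    ; w-algebraMorphism   = λ A → w-algebra
    ; c-algebraMorphism   = λ A → c-algebra
    ; algebraMorphism⇒monoidMorphism = λ f f-alg → algebraMorphism-w f f-alg , algebraMorphism-c f f-alg }

corollary28 : ∀ {o ℓ e o′ ℓ′ e′} (𝓜 : DualLNLModel o ℓ e o′ ℓ′ e′) →
    DualLinearStructure (DualLNLModel.𝓛 𝓜) (inducedMonad 𝓜)
corollary28 𝓜 = Model.dualLinearStructure 𝓜
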